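{- For each prime $p>3$ with $p\equiv 1\bmod 8$ or $p\equiv 3\bmod 8$, there exists a Falconer variety $\mathscr{V}_p$ whose smallest non-trivial member is a loop of order $p$.
   Context: A quasigroup $(Q,\cdot,\backslash,/)$ is a non-empty set $Q$ with three binary operations such that for all $x,y\in Q$: $x\cdot(x\backslash y)=y$, $x\backslash(x\cdot y)=y$, $(y/x)\cdot x=y$, $(y\cdot x)/x=y$. (Equivalently, $(Q,\cdot)$ is such that for all $a,b\in Q$ there exist unique $x,y\in Q$ with $a\cdot x=b$ and $y\cdot a=b$.) A loop is a quasigroup with an element $e$ such that $e\cdot q=q\cdot e=q$ for all $q\in Q$. Quasigroups may be infinite; the order of a quasigroup is the cardinality of its underlying set. Given a set $E$ of quasigroup identities (universally quantified equations between terms in $\cdot,\backslash,/$), the loop variety defined by $E$ is the class of all loops satisfying all identities in $E$. Two quasigroups $(Q,\cdot)$ and $(Q',\circ)$ are isotopic if there are bijections $\alpha,\beta,\gamma:Q\to Q'$ with $\alpha(x)\circ\beta(y)=\gamma(x\cdot y)$ for all $x,y\in Q$. A loop variety is isotopically $L$-closed if it contains every loop that is isotopic to any element of the variety. A variety is anti-associative if the only group (i.e. associative loop) it contains is the trivial group. A member of a variety other than the trivial (one-element) group is called non-trivial, and a variety is non-trivial if it has a non-trivial member. A Falconer variety is a non-trivial, anti-associative, isotopically $L$-closed loop variety. -}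

module Defs where

open import Algebra.Bundles using (Loop)
open import Algebra.Definitions using (Associative)
open import Data.Fin.Base using (Fin)
open import Data.Nat.Base using (ℕ)
open import Data.Product.Base using (Σ; ∃; _×_)
open import Function.Bundles using (Bijection; Injection)
open import Level using (Level; 0ℓ; _⊔_; suc)
open import Relation.Binary.Core using (Rel)
import Relation.Binary.PropositionalEquality.Properties as ≡
open import Relation.Nullary.Negation.Core using (¬_)
open import Relation.Unary using (Pred)

infixl 7 _·_ _⧵_ _⧸_

-- Quasigroup terms; there is deliberately no constant for the loop identity.
data Term : Set where
  var         : ℕ → Term
  _·_ _⧵_ _⧸_ : Term → Term → Term

-- A set of identities: E s t means that the identity s = t belongs to E.
Identities : Set₁
Identities = Rel Term 0ℓ

module _ {c ℓ : Level} (L : Loop c ℓ) where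
  open Loop L

  eval : (ℕ → Carrier) → Term → Carrier
  eval ρ (var i) = ρ i
  eval ρ (s · t) = eval ρ s ∙ eval ρ t
  eval ρ (s ⧵ t) = eval ρ s \\ eval ρ t
  eval ρ (s ⧸ t) = eval ρ s // eval ρ t

  Satisfies : Term → Term → Set (c ⊔ ℓ)
  Satisfies s t = ∀ ρ → eval ρ s ≈ eval ρ t

  IsGroup : Set (c ⊔ ℓ)
  IsGroup = Associative _≈_ _∙_

  Trivial : Set (c ⊔ ℓ)
  Trivial = ∀ x → x ≈ ε

  -- The positive form of the negation of Trivial (classically equivalent to it).
  NonTrivial : Set (c ⊔ ℓ)
  NonTrivial = ∃ λ x → ¬ (x ≈ ε)

  HasOrder : ℕ → Set (c ⊔ ℓ)
  HasOrder n = Bijection (≡.setoid (Fin n)) setoid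

record Isotopism {c ℓ : Level} (L L′ : Loop c ℓ) : Set (c ⊔ ℓ) where
  private
    module L  = Loop L
    module L′ = Loop L′
  field
    α β γ : Bijection L.setoid L′.setoid
  private
    module α = Bijection α
    module β = Bijection β
    module γ = Bijection γ
  field
    isotopic : ∀ x y → (α.to x L′.∙ β.to y) L′.≈ γ.to (x L.∙ y)

module _ (c ℓ : Level) where

  LoopVariety : Identities → Pred (Loop c ℓ) (c ⊔ ℓ)
  LoopVariety E L = ∀ s t → E s t → Satisfies L s t

module _ {c ℓ : Level} (V : Pred (Loop c ℓ) (c ⊔ ℓ)) where

  IsNonTrivialVariety : Set (suc (c ⊔ ℓ))
  IsNonTrivialVariety = Σ (Loop c ℓ) λ L → V L × NonTrivial L

  -- The trivial group lies in every variety, so only uniqueness is asserted.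
  AntiAssociative : Set (suc (c ⊔ ℓ))
  AntiAssociative = ∀ L → V L → IsGroup L → Trivial L

  IsotopicallyLClosed : Set (suc (c ⊔ ℓ))
  IsotopicallyLClosed = ∀ L L′ → V L → Isotopism L L′ → V L′

  -- Orders are compared as cardinals, by injections, since members may be
  -- infinite.
  IsSmallestNonTrivialMember : Loop c ℓ → Set (suc (c ⊔ ℓ))
  IsSmallestNonTrivialMember S =
    V S × NonTrivial S ×
    (∀ L → V L → NonTrivial L → Injection (Loop.setoid S) (Loop.setoid L))

record FalconerVariety (c ℓ : Level) : Set (suc (c ⊔ ℓ)) where
  field
    identities : Identities

  variety : Pred (Loop c ℓ) (c ⊔ ℓ)
  variety = LoopVariety c ℓ identities

  field
    nonTrivial          : IsNonTrivialVariety variety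
    antiAssociative     : AntiAssociative variety
    isotopicallyLClosed : IsotopicallyLClosed variety

{-# OPTIONS --safe #-}
module Submission where

open import Defs
open import Algebra.Bundles using (Loop; Quasigroup)
import Algebra.Properties.Loop as LoopProperties
import Algebra.Properties.Quasigroup as QuasigroupProperties
open import Data.Fin.Base as Fin using (Fin; toℕ)
import Data.Fin.Properties as Fin
open import Data.Integer.Base as ℤ using (ℤ; +_; -_; _+_; _-_; _*_; _^_; 0ℤ; 1ℤ)
import Data.Integer.DivMod as ℤ
import Data.Integer.Divisibility.Signed as ℤ
import Data.Integer.Properties as ℤ
open import Data.Integer.Tactic.RingSolver using (solve-∀)
open import Data.List.Base using (List; []; _∷_; allFin; cartesianProduct)
open import Data.List.Membership.Propositional using (_∈_)
open import Data.List.Membership.Propositional.Properties using (∈-allFin; ∈-cartesianProduct⁺)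
open import Data.List.Relation.Unary.Any using (here; there)
open import Data.Nat.Base as ℕ using (ℕ; zero; suc; z≤n; s≤s; NonZero; _<_; _%_)
import Data.Nat.Coprimality as ℕ
import Data.Nat.Divisibility as ℕ
import Data.Nat.DivMod as ℕ
open import Data.Nat.GCD using (module Bézout)
open import Data.Nat.Primality
  using (Prime; euclidsLemma; prime⇒irreducible; prime⇒nonTrivial; prime⇒nonZero)
import Data.Nat.Properties as ℕ
import Data.Nat.Tactic.RingSolver as ℕ
open import Data.Product.Base using (Σ; ∃; ∃₂; _×_; _,_; proj₁; proj₂)
open import Data.Sum.Base using (_⊎_; inj₁; inj₂; [_,_]′)
open import Function.Bundles using (Bijection; Injection)
open import Level using (Level; Lift; lift; lower; 0ℓ)
open import Relation.Binary.Bundles using (Setoid)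
open import Relation.Binary.PropositionalEquality
  using (_≡_; refl; sym; trans; cong; cong₂; subst; subst₂; module ≡-Reasoning)
import Relation.Binary.PropositionalEquality.Properties as ≡
import Relation.Binary.Reasoning.Setoid as SetoidReasoning
open import Relation.Nullary using (¬_; Dec; yes; no; contradiction)
open import Relation.Nullary.Decidable as Dec using (¬?; _⊎-dec_)

-- Let p ≡ 1, 3 (mod 8), so that - 2 generates a proper subgroup ⟨- 2⟩ of the units mod p, and let N
-- be the complement of {0} ∪ ⟨- 2⟩.  Put ψ x = - 2 x on N and ψ x = x elsewhere.  Then
-- i ∙ j = i - ψ (j - i) is a Latin square on ℤ/p in which any two rows differ by a p-cycle; of N
-- this uses only its invariance under x ↦ - 2 x (the nonsquares would do as well).
--
-- Hence in every loop isotopic to the square the left powers of any y ≠ 1 run through all p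
-- elements, which gives the identity y^p = 1 and forces p distinct left powers in every non-trivial
-- loop satisfying it.  No such isotope is cyclic, so for each y ≠ 1 there are i, j, m with
-- yⁱ yʲ = yᵐ and m ≢ i + j.  The term L_y^{p - m} (yⁱ yʲ) then equals 1 at y, whereas in a group
-- it is a power of y prime to p.  Composing finitely many such terms yields a one-variable identity
-- valid in all isotopes of the square but in no non-trivial group of exponent p.

-- Off `N` the square has the entry 2 i - j and on `N` the entry 2 j - i, so it is patched together
-- from two Latin squares that are each isotopic to ℤ/p. The patches differ by the factor - 2 on the
-- offset j - i; invariance of `N` under - 2 therefore keeps the rows Latin, and the columns too,
-- because 2 x = - (- 2 x). The congruence on p enters through Gauss's lemma: - 2 is then a square,
-- its powers fill at most half of the units, and `N` is not empty. That p exceeds 3 makes 3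
-- invertible, on which the proof that no isotope is cyclic rests. The hard point is the single
-- cycle. Off `N` two crossings merely advance by two on the same sheet, so everything depends on
-- the gaps between consecutive elements of `N`, and on their parity: a gap of odd length returns to
-- its sheet, one of even length exchanges the sheets. Multiplication by - 2 compares a gap of
-- length j with a stretch of length 2 j read in steps of two, which reduces an even gap to a
-- shorter one.

parity : ∀ n → ∃ λ k → n ≡ k ℕ.+ k ⊎ n ≡ suc (k ℕ.+ k)
parity zero = 0 , inj₁ refl
parity (suc n) with parity n
... | k , inj₁ eq = k , inj₂ (cong suc eq)
... | k , inj₂ eq = suc k , inj₁ (trans (cong suc eq) (cong suc (sym (ℕ.+-suc k k))))

least : ∀ {P : ℕ → Set} → (∀ i → Dec (P i)) → ∀ k → P k →
        ∃ λ i → i ℕ.≤ k × P i × (∀ j → j ℕ.< i → ¬ P j)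
least P? k Pk with P? 0
... | yes P0 = 0 , z≤n , P0 , λ _ ()
least P? zero    P0 | no ¬P0 = contradiction P0 ¬P0
least P? (suc k) Pk | no ¬P0 with least (λ i → P? (suc i)) k Pk
... | i , i≤k , Pi , min = suc i , s≤s i≤k , Pi ,
      λ { zero _ → ¬P0 ; (suc j) (s≤s j<i) → min j j<i }

-- Congruence of integers modulo n.

module Congruence (n : ℕ) where

  infix 4 _≈_ _≈?_

  record _≈_ (a b : ℤ) : Set where
    constructor mod
    field dvd : + n ℤ.∣ a - b
  open _≈_ public

  ≡⇒≈ : ∀ {a b} → a ≡ b → a ≈ b
  ≡⇒≈ {a} refl = mod (ℤ.divides 0ℤ (ℤ.+-inverseʳ a))

  combine₁ : ∀ {a b e f} k → a ≈ b → e - f ≡ k * (a - b) → e ≈ f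
  combine₁ k (mod d) eq = mod (subst (+ n ℤ.∣_) (sym eq) (ℤ.∣n⇒∣m*n k d))

  combine₂ : ∀ {a b c d e f} k l → a ≈ b → c ≈ d → e - f ≡ k * (a - b) + l * (c - d) → e ≈ f
  combine₂ k l (mod d) (mod d′) eq =
    mod (subst (+ n ℤ.∣_) (sym eq) (ℤ.∣m∣n⇒∣m+n (ℤ.∣n⇒∣m*n k d) (ℤ.∣n⇒∣m*n l d′)))

  ≈-setoid : Setoid 0ℓ 0ℓ
  ≈-setoid = record
    { Carrier       = ℤ
    ; _≈_           = _≈_
    ; isEquivalence = record
      { refl  = ≡⇒≈ refl
      ; sym   = λ {a} {b} p → combine₁ (- 1ℤ) p (sym-eq a b)
      ; trans = λ {a} {b} {c} p q → combine₂ 1ℤ 1ℤ p q (trans-eq a b c)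
      }
    }
    where
    sym-eq : ∀ a b → b - a ≡ - 1ℤ * (a - b)
    sym-eq = solve-∀
    trans-eq : ∀ a b c → a - c ≡ 1ℤ * (a - b) + 1ℤ * (b - c)
    trans-eq = solve-∀

  open Setoid ≈-setoid public using () renaming (refl to ≈-refl; sym to ≈-sym; trans to ≈-trans)

  _≈?_ : ∀ a b → Dec (a ≈ b)
  a ≈? b = Dec.map′ mod dvd (+ n ℤ.∣? a - b)

  +-cong : ∀ {a b c d} → a ≈ b → c ≈ d → a + c ≈ b + d
  +-cong {a} {b} {c} {d} p q = combine₂ 1ℤ 1ℤ p q (eq a b c d)
    where
    eq : ∀ a b c d → a + c - (b + d) ≡ 1ℤ * (a - b) + 1ℤ * (c - d)
    eq = solve-∀

  neg-cong : ∀ {a b} → a ≈ b → - a ≈ - b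
  neg-cong {a} {b} p = combine₁ (- 1ℤ) p (eq a b)
    where
    eq : ∀ a b → - a - - b ≡ - 1ℤ * (a - b)
    eq = solve-∀

  *-cong : ∀ {a b c d} → a ≈ b → c ≈ d → a * c ≈ b * d
  *-cong {a} {b} {c} {d} p q = combine₂ c b p q (eq a b c d)
    where
    eq : ∀ a b c d → a * c - b * d ≡ c * (a - b) + b * (c - d)
    eq = solve-∀

  n≈0 : + n ≈ 0ℤ
  n≈0 = mod (ℤ.divides 1ℤ (eq (+ n)))
    where
    eq : ∀ x → x - 0ℤ ≡ 1ℤ * x
    eq = solve-∀

  -- Adding `l` full turns makes the representative as late as desired; later, residues are visited
  -- at times beyond a given bound.
  representative : .{{_ : ℕ.NonZero n}} → ∀ a l → ∃ λ t → l ℕ.≤ t × a ≈ + t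
  representative a l = a ℤ.%ℕ n ℕ.+ l ℕ.* n , ℕ.≤-trans (ℕ.m≤m*n l n) (ℕ.m≤n+m _ _) ,
    mod (ℤ.divides (a ℤ./ℕ n - + l) (trans
      (cong₂ _-_ (ℤ.a≡a%ℕn+[a/ℕn]*n a n) (cong (λ z → + (a ℤ.%ℕ n) + z) (ℤ.pos-* l n)))
      (eq (+ (a ℤ.%ℕ n)) (a ℤ./ℕ n) (+ l) (+ n))))
    where
    eq : ∀ r q l n → (r + q * n) - (r + l * n) ≡ (q - l) * n
    eq = solve-∀

module OddCongruence (m : ℕ) where
  open Congruence (suc (m ℕ.+ m))

  -- Division by - 2: `suc m` is the inverse of 2 modulo 2 m + 1.
  -½ : ℤ → ℤ
  -½ b = - + suc m * b

  -2*-½ : ∀ b → - + 2 * -½ b ≈ b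
  -2*-½ b = mod (ℤ.divides b (eq (+ m) b))
    where
    eq : ∀ m b → - + 2 * (- (1ℤ + m) * b) - b ≡ b * (1ℤ + (m + m))
    eq = solve-∀

-- A walk between two copies of ℤ/p with a single orbit.

record DoublingClosed (p : ℕ) : Set₁ where
  open Congruence p
  field
    N      : ℤ → Set
    N?     : ∀ x → Dec (N x)
    N-resp : ∀ {x y} → x ≈ y → N x → N y
    double : ∀ {x} → N x → N (- + 2 * x)
    halve  : ∀ {x} → N (- + 2 * x) → N x

-- H x and K x label the gaps between x - 1 and x in two copies of ℤ/p.  Crossing at x from one copy
-- to the other stays at x off N and moves to - 2 x, or back, on N.
record TwoSheets (p : ℕ) (M : DoublingClosed p) (A : Setoid 0ℓ 0ℓ) : Set where
  open Congruence p
  open DoublingClosed M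
  open Setoid A using (Carrier) renaming (_≈_ to _~_)
  field
    H K     : ℤ → Carrier
    H-cong  : ∀ {x y} → x ≈ y → H x ~ H y
    K-cong  : ∀ {x y} → x ≈ y → K x ~ K y
    HK-fix  : ∀ {x} → ¬ N x → H x ~ K (x + 1ℤ)
    KH-fix  : ∀ {x} → ¬ N x → K x ~ H (x + 1ℤ)
    HK-move : ∀ {x} → N x → H x ~ K (- + 2 * x + 1ℤ)
    KH-move : ∀ {x} → N x → K (- + 2 * x) ~ H (x + 1ℤ)

module SingleOrbit (m : ℕ) (M : DoublingClosed (suc (m ℕ.+ m)))
  (A : Setoid 0ℓ 0ℓ) (T : TwoSheets (suc (m ℕ.+ m)) M A) where

  n : ℕ
  n = suc (m ℕ.+ m)

  open Congruence n
  open OddCongruence m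
  open DoublingClosed M
  open TwoSheets T
  open Setoid A using () renaming (Carrier to Carrierᴬ; _≈_ to _~_)

  private
    module ~ = Setoid A

  cong-≡ : ∀ {x y} (F : ℤ → Carrierᴬ) → x ≡ y → F x ~ F y
  cong-≡ F refl = ~.refl

  -- Off `N` each crossing advances by one and changes the sheet, so crossings taken in pairs stay
  -- on it.
  walk : ∀ k x → (∀ i → i ℕ.< k ℕ.+ k → ¬ N (x + + i)) →
         H x ~ H (x + + (k ℕ.+ k)) × K x ~ K (x + + (k ℕ.+ k))
  walk zero x ∉N = cong-≡ H (sym (ℤ.+-identityʳ x)) , cong-≡ K (sym (ℤ.+-identityʳ x))
  walk (suc k) x ∉N rewrite ℕ.+-suc k k with walk k x (λ i i<k → ∉N i (ℕ.<-trans i<k (ℕ.m<n⇒m<1+n ℕ.≤-refl)))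
  ... | h , κ =
      ~.trans h (~.trans (HK-fix ∉N₀) (~.trans (cong-≡ K eq₁) (~.trans (KH-fix ∉N₁) (cong-≡ H eq₂))))
    , ~.trans κ (~.trans (KH-fix ∉N₀) (~.trans (cong-≡ H eq₁) (~.trans (HK-fix ∉N₁) (cong-≡ K eq₂))))
    where
    shift : ∀ x j → x + j + 1ℤ ≡ x + (1ℤ + j)
    shift = solve-∀
    eq₁ = shift x (+ (k ℕ.+ k))
    eq₂ = shift x (+ suc (k ℕ.+ k))
    ∉N₀ = ∉N (k ℕ.+ k) (ℕ.m<n⇒m<1+n ℕ.≤-refl)
    ∉N₁ = ∉N (suc (k ℕ.+ k)) ℕ.≤-refl

  record Gap (a : ℤ) (j : ℕ) : Set where
    field
      start  : N a
      end    : N (a + + j)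
      inside : ∀ i → 0 ℕ.< i → i ℕ.< j → ¬ N (a + + i)

  -- Odd offsets are left unconstrained: this is what x ↦ - 2 x makes of a gap of length `j`.
  record Gap₂ (a : ℤ) (j : ℕ) : Set where
    field
      start  : N a
      end    : N (a + + (j ℕ.+ j))
      inside : ∀ i → 0 ℕ.< i → i ℕ.< j → ¬ N (a + + (i ℕ.+ i))

  Across : ℕ → Set
  Across j = ∀ {a} → Gap a j → H (a + 1ℤ) ~ H (a + + j) × K (a + 1ℤ) ~ K (a + + j)

  gap⇒gap₂ : ∀ {a j} → Gap a (j ℕ.+ j) → Gap₂ a j
  gap⇒gap₂ g = record
    { start  = Gap.start g
    ; end    = Gap.end g
    ; inside = λ i 0<i i<j → Gap.inside g (i ℕ.+ i) (ℕ.<-≤-trans 0<i (ℕ.m≤m+n i i)) (ℕ.+-mono-< i<j i<j)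
    }

  -- x ↦ - 2 x carries a gap from v to the numbers of one parity, in reverse.
  skip : ∀ {j} → Across j → ∀ {a} → Gap₂ a j → K (a + 1ℤ) ~ K (a + + (j ℕ.+ j))
  skip {j} across {a} g = ~.sym (begin
    K (a + + (j ℕ.+ j))           ≈⟨ K-cong (≈-sym -2v≈b) ⟩
    K (- + 2 * v)                 ≈⟨ KH-move v∈N ⟩
    H (v + 1ℤ)                    ≈⟨ proj₁ (across gapᵛ) ⟩
    H (v + + j)                   ≈⟨ HK-move (Gap.end gapᵛ) ⟩
    K (- + 2 * (v + + j) + 1ℤ)    ≈⟨ K-cong (+-cong (image 0 j refl) ≈-refl) ⟩
    K (a + 0ℤ + 1ℤ)               ≈⟨ cong-≡ K (cong (_+ 1ℤ) (ℤ.+-identityʳ a)) ⟩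
    K (a + 1ℤ)                    ∎)
    where
    open import Relation.Binary.Reasoning.Setoid A
    v = -½ (a + + (j ℕ.+ j))
    -2v≈b = -2*-½ (a + + (j ℕ.+ j))
    v∈N : N v
    v∈N = halve (N-resp (≈-sym -2v≈b) (Gap₂.end g))
    eq : ∀ a v i i′ → - + 2 * (v + i) - (a + (i′ + i′)) ≡ 1ℤ * (- + 2 * v - (a + ((i′ + i) + (i′ + i))))
    eq = solve-∀
    image : ∀ i′ i → i′ ℕ.+ i ≡ j → - + 2 * (v + + i) ≈ a + + (i′ ℕ.+ i′)
    image i′ i refl = combine₁ 1ℤ -2v≈b (eq a v (+ i) (+ i′))
    gapᵛ : Gap v j
    gapᵛ = record
      { start  = v∈N
      ; end    = halve (N-resp (≈-sym (image 0 j refl)) (subst N (sym (ℤ.+-identityʳ a)) (Gap₂.start g)))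
      ; inside = λ i 0<i i<j v+i∈N → Gap₂.inside g (j ℕ.∸ i) (ℕ.m<n⇒0<n∸m i<j) (ℕ.∸-monoʳ-< 0<i (ℕ.<⇒≤ i<j))
          (N-resp (image (j ℕ.∸ i) i (ℕ.m∸n+n≡m (ℕ.<⇒≤ i<j))) (double v+i∈N))
      }

  walk-gap : ∀ k {j a} → k ℕ.+ k ℕ.≤ j → Gap a (suc j) →
    H (a + 1ℤ) ~ H (a + + suc (k ℕ.+ k)) × K (a + 1ℤ) ~ K (a + + suc (k ℕ.+ k))
  walk-gap k {j} {a} 2k≤j g with walk k (a + 1ℤ) (λ i i<2k → subst (λ z → ¬ N z) (sym (ℤ.+-assoc a 1ℤ (+ i)))
    (Gap.inside g (suc i) (s≤s z≤n) (s≤s (ℕ.<-≤-trans i<2k 2k≤j))))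
  ... | h , κ = ~.trans h (cong-≡ H assoc) , ~.trans κ (cong-≡ K assoc)
    where
    assoc = ℤ.+-assoc a 1ℤ (+ (k ℕ.+ k))

  -- From `a + 1` to the end of a gap of even length there is an odd number of crossings, hence a
  -- change of sheet.
  odd-walk : ∀ k {a} → Gap a (suc (suc (k ℕ.+ k))) →
    H (a + 1ℤ) ~ K (a + + suc (suc (k ℕ.+ k))) × K (a + 1ℤ) ~ H (a + + suc (suc (k ℕ.+ k)))
  odd-walk k {a} g with walk-gap k (ℕ.n≤1+n _) g
  ... | h , κ = ~.trans h (~.trans (HK-fix ∉N) (cong-≡ K eq)) , ~.trans κ (~.trans (KH-fix ∉N) (cong-≡ H eq))
    where
    ∉N = Gap.inside g (suc (k ℕ.+ k)) (s≤s z≤n) ℕ.≤-refl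
    shift : ∀ x j → x + j + 1ℤ ≡ x + (1ℤ + j)
    shift = solve-∀
    eq = shift a (+ suc (k ℕ.+ k))

  -- For odd length the crossings pair up. For even length both walks change the sheet, and `skip`,
  -- applied to the gap of half the length, joins the two ends on `K`; composing the three gives the
  -- claim for `H`. The halving is the recursion.
  across : ∀ {j} → Across (suc j)
  across {j} = go (suc j) j ℕ.≤-refl
    where
    go : ∀ f j → j ℕ.< f → Across (suc j)
    go (suc f) j (s≤s j≤f) {a} g with parity j
    ... | k , inj₁ refl = walk-gap k ℕ.≤-refl g
    ... | k , inj₂ refl with odd-walk k g
    ...   | h , κ = ~.trans h (~.trans (~.sym s) κ) , s
      where
      2+2k = sym (ℕ.+-suc (suc k) k)
      s : K (a + 1ℤ) ~ K (a + + suc (suc (k ℕ.+ k)))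
      s = subst (λ z → K (a + 1ℤ) ~ K (a + + z)) (sym 2+2k)
            (skip (go f k (ℕ.≤-trans (s≤s (ℕ.m≤m+n k k)) j≤f)) (gap⇒gap₂ (subst (Gap a) 2+2k g)))

  -- An even gap can be passed both with a change of sheet (`odd-walk`) and without one (`across`),
  -- which identifies the sheets.
  fold : ∀ k {a} → Gap a (suc k ℕ.+ suc k) → H (a + 1ℤ) ~ K (a + 1ℤ)
  fold k {a} g = ~.trans (proj₁ (odd-walk k g′)) (~.sym (proj₂ (across g′)))
    where
    g′ = subst (Gap a) (ℕ.+-suc (suc k) k) g


  0<suc : ∀ {k} → 0 ℕ.< suc k
  0<suc = s≤s z≤n

  module From (a₀ : ℤ) (a₀∈N : N a₀) where

    -- Positions are natural numbers, not residues, so that they have a parity. As n is odd, each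
    -- full turn exchanges the parities.
    at : ℕ → ℤ
    at t = a₀ + + t

    at-+ : ∀ t i → at t + + i ≡ at (t ℕ.+ i)
    at-+ t i = ℤ.+-assoc a₀ (+ t) (+ i)

    a+n∈N : ∀ {a} → N a → N (a + + n)
    a+n∈N {a} = N-resp (≈-sym (combine₁ 1ℤ n≈0 (eq a (+ n))))
      where
      eq : ∀ a n → a + n - a ≡ 1ℤ * (n - 0ℤ)
      eq = solve-∀

    -- u < w are the last positions in N of either parity, up to time t.  The value of K just after
    -- the earlier one does not depend on t.
    record State (c : Carrierᴬ) (t : ℕ) : Set where
      constructor state
      field
        u k r : ℕ
      w = suc (u ℕ.+ (k ℕ.+ k))
      field
        time   : t ≡ w ℕ.+ r
        u∈N    : N (at u)
        w∈N    : N (at w)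
        value  : K (at u + 1ℤ) ~ c
        last-u : ∀ i → 0 ℕ.< i → u ℕ.+ (i ℕ.+ i) ℕ.≤ t → ¬ N (at (u ℕ.+ (i ℕ.+ i)))
        last-w : ∀ i → 0 ℕ.< i → w ℕ.+ (i ℕ.+ i) ℕ.≤ t → ¬ N (at (w ℕ.+ (i ℕ.+ i)))

    EvenGapTo : ℤ → Set
    EvenGapTo b = ∃₂ λ a j → 0 ℕ.< j × Gap a (j ℕ.+ j) × a + + (j ℕ.+ j) ≈ b

    ≤-suc-cases : ∀ {P : ℕ → Set} {s t} → s ℕ.≤ suc t → (s ℕ.≤ t → P s) → (s ≡ suc t → P s) → P s
    ≤-suc-cases s≤1+t f g with ℕ.m≤n⇒m<n∨m≡n s≤1+t
    ... | inj₁ (s≤s s≤t) = f s≤t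
    ... | inj₂ eq = g eq

    even≢odd : ∀ i j → i ℕ.+ i ≡ suc (j ℕ.+ j) → ∀ {A : Set} → A
    even≢odd i j eq = contradiction (trans (double≡ i) (trans eq (cong suc (sym (double≡ j))))) (ℕ.even≢odd i j)
      where
      double≡ : ∀ i → 2 ℕ.* i ≡ i ℕ.+ i
      double≡ i = cong (i ℕ.+_) (ℕ.+-identityʳ i)

    not-after : ∀ {s i} → 0 ℕ.< i → s ℕ.+ (i ℕ.+ i) ℕ.≤ s → ∀ {A : Set} → A
    not-after {s} {suc i} _ le = contradiction le (ℕ.m+1+n≰m s)

    -- A new element of `N` closes a gap that begins at `w`. At odd distance it has the parity of
    -- `u`: `skip` carries the value from `u` to it, and `across` carries it back to `w`, which
    -- becomes the new `u`. At even distance only `w` is replaced, and an even gap is reported.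
    step : ∀ {c t} → State c t →
           State c (suc t) × (N (at (suc t)) → K (at (suc t)) ~ c ⊎ EvenGapTo (at (suc t)))
    step {c} {t} st@(state u k r refl u∈N w∈N value last-u last-w) with N? (at (suc t))
    ... | no ∉N = state u k (suc r) (sym (ℕ.+-suc w r)) u∈N w∈N value
                    (λ i 0<i le → ≤-suc-cases {λ s → ¬ N (at s)} le (last-u i 0<i)
                       (λ eq → subst (λ s → ¬ N (at s)) (sym eq) ∉N))
                    (λ i 0<i le → ≤-suc-cases {λ s → ¬ N (at s)} le (last-w i 0<i)
                       (λ eq → subst (λ s → ¬ N (at s)) (sym eq) ∉N))
                , λ ∈N → contradiction ∈N ∉N
      where w = State.w st
    ... | yes ∈N = next (parity (suc r))
      where
      w = State.w st
      t≡ : w ℕ.+ suc r ≡ suc t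
      t≡ = ℕ.+-suc w r
      -- Points at even distance from `w` are excluded by `last-w`; those at odd distance have the
      -- parity of `u` and are excluded by `last-u`.
      inside : ∀ i → 0 ℕ.< i → i ℕ.< suc r → ¬ N (at w + + i)
      inside i 0<i (s≤s i≤r) rewrite at-+ w i with parity i
      ... | zero , inj₁ refl = contradiction 0<i λ ()
      ... | suc j , inj₁ refl = last-w (suc j) 0<suc (ℕ.+-monoʳ-≤ w i≤r)
      ... | j , inj₂ refl = subst (λ s → s ℕ.≤ t → ¬ N (at s)) (eq u k j)
        (last-u (suc (k ℕ.+ j)) 0<suc) (ℕ.+-monoʳ-≤ w i≤r)
        where
        eq : ∀ u k j → u ℕ.+ (suc (k ℕ.+ j) ℕ.+ suc (k ℕ.+ j)) ≡ suc (u ℕ.+ (k ℕ.+ k)) ℕ.+ suc (j ℕ.+ j)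
        eq = ℕ.solve-∀
      gap : Gap (at w) (suc r)
      gap = record
        { start  = w∈N
        ; end    = subst N (sym (trans (at-+ w (suc r)) (cong at t≡))) ∈N
        ; inside = inside
        }
      K-end : K (at w + + suc r) ~ K (at (suc t))
      K-end = cong-≡ K (trans (at-+ w (suc r)) (cong at t≡))
      next : (∃ λ j → suc r ≡ j ℕ.+ j ⊎ suc r ≡ suc (j ℕ.+ j)) →
             State c (suc t) × (N (at (suc t)) → K (at (suc t)) ~ c ⊎ EvenGapTo (at (suc t)))
      next (zero , inj₁ ())
      next (suc j , inj₁ r≡) =
          state u (k ℕ.+ suc j) 0 time′ u∈N (subst (λ s → N (at s)) (trans time′ (ℕ.+-identityʳ _)) ∈N) value
            (λ i 0<i le → ≤-suc-cases {λ s → ¬ N (at s)} le (last-u i 0<i)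
               (λ eq → even≢odd i (k ℕ.+ suc j) (ℕ.+-cancelˡ-≡ u _ _ (trans eq (trans time′ (odd u k j))))))
            (λ i 0<i le → not-after 0<i (ℕ.≤-trans le (ℕ.≤-reflexive (trans time′ (ℕ.+-identityʳ _)))))
        , λ _ → inj₂ (at w , suc j , 0<suc , subst (Gap (at w)) r≡ gap
                     , ≡⇒≈ (trans (at-+ w (suc j ℕ.+ suc j)) (cong at (trans (cong (w ℕ.+_) (sym r≡)) t≡))))
        where
        arith : ∀ u k j → suc (u ℕ.+ (k ℕ.+ k)) ℕ.+ (suc j ℕ.+ suc j) ≡
                suc (u ℕ.+ ((k ℕ.+ suc j) ℕ.+ (k ℕ.+ suc j))) ℕ.+ 0
        arith = ℕ.solve-∀
        odd : ∀ u k j → suc (u ℕ.+ ((k ℕ.+ suc j) ℕ.+ (k ℕ.+ suc j))) ℕ.+ 0 ≡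
              u ℕ.+ suc ((k ℕ.+ suc j) ℕ.+ (k ℕ.+ suc j))
        odd = ℕ.solve-∀
        time′ : suc t ≡ suc (u ℕ.+ ((k ℕ.+ suc j) ℕ.+ (k ℕ.+ suc j))) ℕ.+ 0
        time′ = trans (sym t≡) (trans (cong (w ℕ.+_) r≡) (arith u k j))
      next (j , inj₂ r≡) =
          state w j 0 time′ w∈N (subst (λ s → N (at s)) (trans time′ (ℕ.+-identityʳ _)) ∈N)
            (~.trans (proj₂ (across gap)) (~.trans K-end K≈c))
            (λ i 0<i le → ≤-suc-cases {λ s → ¬ N (at s)} le (last-w i 0<i)
               (λ eq → even≢odd i j (ℕ.+-cancelˡ-≡ w _ _ (trans eq (trans time′ (odd w j))))))
            (λ i 0<i le → not-after 0<i (ℕ.≤-trans le (ℕ.≤-reflexive (trans time′ (ℕ.+-identityʳ _)))))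
        , λ _ → inj₁ K≈c
        where
        odd : ∀ w j → suc (w ℕ.+ (j ℕ.+ j)) ℕ.+ 0 ≡ w ℕ.+ suc (j ℕ.+ j)
        odd = ℕ.solve-∀
        time′ : suc t ≡ suc (w ℕ.+ (j ℕ.+ j)) ℕ.+ 0
        time′ = trans (sym t≡) (trans (cong (w ℕ.+_) r≡) (sym (odd w j)))
        l = suc (k ℕ.+ j)
        arith : ∀ u k j → u ℕ.+ (suc (k ℕ.+ j) ℕ.+ suc (k ℕ.+ j)) ≡ suc (suc (u ℕ.+ (k ℕ.+ k)) ℕ.+ (j ℕ.+ j)) ℕ.+ 0
        arith = ℕ.solve-∀
        end≡ : at u + + (l ℕ.+ l) ≡ at (suc t)
        end≡ = trans (at-+ u (l ℕ.+ l)) (cong at (trans (arith u k j) (sym time′)))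
        gap₂ : Gap₂ (at u) l
        gap₂ = record
          { start  = u∈N
          ; end    = subst N (sym end≡) ∈N
          ; inside = λ i 0<i i<l → subst (λ z → ¬ N z) (sym (at-+ u (i ℕ.+ i)))
              (last-u i 0<i (ℕ.s≤s⁻¹ (ℕ.<-≤-trans (ℕ.+-monoʳ-< u (ℕ.+-mono-< i<l i<l))
                (ℕ.≤-reflexive (trans (arith u k j) (sym time′))))))
          }
        K≈c : K (at (suc t)) ~ c
        K≈c = ~.trans (cong-≡ K (sym end≡)) (~.trans (~.sym (skip across gap₂)) value)

    -- After one turn both parities have been met: a₀ occurs at time 0 and again at the odd time n,
    -- which serves as `w`. Counting back from `m` finds the last even time for `u`.
    initial : ∃ λ c → State c n
    initial with least (λ i → N? (at ((m ℕ.∸ i) ℕ.+ (m ℕ.∸ i)))) m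
      (subst (λ z → N (at (z ℕ.+ z))) (sym (ℕ.n∸n≡0 m)) (subst N (sym (ℤ.+-identityʳ a₀)) a₀∈N))
    ... | i , i≤m , Pi , min = K (at (e ℕ.+ e) + 1ℤ) , state (e ℕ.+ e) i 0 time Pi
            (subst (λ s → N (at s)) (trans time (ℕ.+-identityʳ _)) (a+n∈N a₀∈N)) ~.refl last-u
            (λ j 0<j le → not-after 0<j (ℕ.≤-trans le (ℕ.≤-reflexive (trans time (ℕ.+-identityʳ _)))))
      where
      e = m ℕ.∸ i
      e+i≡m : e ℕ.+ i ≡ m
      e+i≡m = ℕ.m∸n+n≡m i≤m
      arith : ∀ e i → suc ((e ℕ.+ i) ℕ.+ (e ℕ.+ i)) ≡ suc ((e ℕ.+ e) ℕ.+ (i ℕ.+ i)) ℕ.+ 0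
      arith = ℕ.solve-∀
      time : n ≡ suc ((e ℕ.+ e) ℕ.+ (i ℕ.+ i)) ℕ.+ 0
      time = trans (cong (λ z → suc (z ℕ.+ z)) (sym e+i≡m)) (arith e i)
      double-≤ : ∀ j i → j ℕ.+ j ℕ.≤ suc (i ℕ.+ i) → j ℕ.≤ i
      double-≤ zero i _ = z≤n
      double-≤ (suc j) zero (s≤s le) with () ← subst (ℕ._≤ 0) (ℕ.+-suc j j) le
      double-≤ (suc j) (suc i) (s≤s le) with s≤s le′ ← subst (ℕ._≤ suc i ℕ.+ suc i) (ℕ.+-suc j j) le =
        s≤s (double-≤ j i (subst (j ℕ.+ j ℕ.≤_) (ℕ.+-suc i i) le′))
      last-u : ∀ j → 0 ℕ.< j → (e ℕ.+ e) ℕ.+ (j ℕ.+ j) ℕ.≤ n → ¬ N (at ((e ℕ.+ e) ℕ.+ (j ℕ.+ j)))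
      last-u j 0<j le = subst (λ z → ¬ N (at z)) (trans (cong (λ z → z ℕ.+ z) m∸[i∸j]≡) (swap e j))
        (min (i ℕ.∸ j) (ℕ.∸-monoʳ-< 0<j j≤i))
        where
        swap : ∀ e j → (e ℕ.+ j) ℕ.+ (e ℕ.+ j) ≡ (e ℕ.+ e) ℕ.+ (j ℕ.+ j)
        swap = ℕ.solve-∀
        odd : ∀ e i → suc ((e ℕ.+ e) ℕ.+ (i ℕ.+ i)) ℕ.+ 0 ≡ (e ℕ.+ e) ℕ.+ suc (i ℕ.+ i)
        odd = ℕ.solve-∀
        j≤i : j ℕ.≤ i
        j≤i = double-≤ j i (ℕ.+-cancelˡ-≤ (e ℕ.+ e) _ _ (ℕ.≤-trans le (ℕ.≤-reflexive (trans time (odd e i)))))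
        m∸[i∸j]≡ : m ℕ.∸ (i ℕ.∸ j) ≡ e ℕ.+ j
        m∸[i∸j]≡ = trans (cong (ℕ._∸ (i ℕ.∸ j))
            (trans (sym e+i≡m) (trans (cong (e ℕ.+_) (sym (ℕ.m+[n∸m]≡n j≤i))) (sym (ℕ.+-assoc e j (i ℕ.∸ j))))))
          (ℕ.m+n∸n≡m (e ℕ.+ j) (i ℕ.∸ j))

    c : Carrierᴬ
    c = proj₁ initial

    state-at : ∀ s → State c (s ℕ.+ n)
    state-at zero    = proj₂ initial
    state-at (suc s) = proj₁ (step (state-at s))

    lift-to : ∀ b s → ∃ λ t → s ℕ.≤ t × b ≈ at t
    lift-to b s with representative (b - a₀) s
    ... | t , s≤t , b-a₀≈t = t , s≤t , combine₁ 1ℤ b-a₀≈t (eq b a₀ (+ t))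
      where
      eq : ∀ b a t → b - (a + t) ≡ 1ℤ * ((b - a) - t)
      eq = solve-∀

    -- Every residue recurs after time n, when a state is available, so the `step` that arrives at
    -- `b` decides.
    K≈c-or-gap : ∀ {b} → N b → K b ~ c ⊎ EvenGapTo b
    K≈c-or-gap {b} b∈N with lift-to b (suc n)
    ... | suc t , s≤s n≤t , b≈t
      with proj₂ (step (subst (State c) (ℕ.m∸n+n≡m n≤t) (state-at (t ℕ.∸ n)))) (N-resp b≈t b∈N)
    ...   | inj₁ K≈c = inj₁ (~.trans (K-cong b≈t) K≈c)
    ...   | inj₂ (a , j , 0<j , g , end≈) = inj₂ (a , j , 0<j , g , ≈-trans end≈ (≈-sym b≈t))

    gap≤n : ∀ {a j} → Gap a j → j ℕ.≤ n
    gap≤n g = ℕ.≮⇒≥ λ n<j → Gap.inside g n 0<suc n<j (a+n∈N (Gap.start g))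

    -- The left neighbour of - 2 a in N is at an odd distance, which is settled, or at an even distance
    -- of at least twice the length of the gap; so the recursion stops at a gap longer than n.
    even-gap : ∀ f {a j} → 0 ℕ.< j → n ℕ.< f ℕ.+ j → Gap a (j ℕ.+ j) → K (a + + (j ℕ.+ j)) ~ c
    even-gap zero {j = j} 0<j n<j g = contradiction (ℕ.≤-trans (ℕ.m≤m+n j j) (gap≤n g)) (ℕ.<⇒≱ n<j)
    even-gap (suc f) {a} {suc k} 0<j n<f+j g =
      ~.trans (~.sym (proj₂ (across g))) (~.trans (~.sym (fold k g)) (~.trans (~.sym (KH-move (Gap.start g)))
        (image (K≈c-or-gap (double (Gap.start g))))))
      where
      j = suc k
      image : K (- + 2 * a) ~ c ⊎ EvenGapTo (- + 2 * a) → K (- + 2 * a) ~ c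
      image (inj₁ K≈c) = K≈c
      image (inj₂ (a′ , i , 0<i , g′ , end≈)) = ~.trans (K-cong (≈-sym end≈)) (even-gap f 0<i n<f+i g′)
        where
        eq : ∀ a a′ i → a′ - - + 2 * (a + i) ≡ 1ℤ * (a′ + (i + i) - - + 2 * a)
        eq = solve-∀
        a+i∈N : N (a + + i)
        a+i∈N = halve (N-resp (combine₁ 1ℤ end≈ (eq a a′ (+ i))) (Gap.start g′))
        2j≤i : j ℕ.+ j ℕ.≤ i
        2j≤i = ℕ.≮⇒≥ λ i<2j → Gap.inside g i 0<i i<2j a+i∈N
        n<f+i : n ℕ.< f ℕ.+ i
        n<f+i = ℕ.<-≤-trans n<f+j (ℕ.≤-trans
          (ℕ.≤-trans (ℕ.≤-reflexive (sym (ℕ.+-suc f j))) (ℕ.+-monoʳ-≤ f (s≤s (ℕ.m≤n+m j k))))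
          (ℕ.+-monoʳ-≤ f 2j≤i))

    K≈c : ∀ {b} → N b → K b ~ c
    K≈c b∈N with K≈c-or-gap b∈N
    ... | inj₁ K≈c = K≈c
    ... | inj₂ (a , j , 0<j , g , end≈) =
      ~.trans (K-cong (≈-sym end≈)) (even-gap (suc n) 0<j (s≤s (ℕ.m≤m+n n j)) g)

    -- Both values are carried to elements of `N`, where `K≈c` applies: the one on `H` by a move to
    -- - 2 a, the one on `K` across the gap to its right end.
    after : ∀ {a} → N a → H (a + 1ℤ) ~ c × K (a + 1ℤ) ~ c
    after {a} a∈N with least (λ i → N? (a + + suc i)) (m ℕ.+ m) (a+n∈N a∈N)
    ... | i , _ , end , min =
        ~.trans (~.sym (KH-move a∈N)) (K≈c (double a∈N))
      , ~.trans (proj₂ (across gap)) (K≈c end)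
      where
      gap : Gap a (suc i)
      gap = record { start = a∈N ; end = end ; inside = λ { (suc j) _ (s≤s j<i) → min j j<i } }

    constant-at : ∀ t → H (at (suc t)) ~ c × K (at (suc t)) ~ c
    constant-at zero = after a₀∈N
    constant-at (suc t) with N? (at (suc t)) | constant-at t
    ... | yes ∈N | _ = subst (λ z → H z ~ c × K z ~ c) (eq a₀ (+ suc t)) (after ∈N)
      where
      eq : ∀ a t → a + t + 1ℤ ≡ a + (1ℤ + t)
      eq = solve-∀
    ... | no ∉N  | h , κ = subst (λ z → H z ~ c × K z ~ c) (eq a₀ (+ suc t))
                             (~.trans (~.sym (KH-fix ∉N)) κ , ~.trans (~.sym (HK-fix ∉N)) h)
      where
      eq : ∀ a t → a + t + 1ℤ ≡ a + (1ℤ + t)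
      eq = solve-∀

    H≈c : ∀ x → H x ~ c
    H≈c x with lift-to x 1
    ... | suc t , _ , x≈t = ~.trans (H-cong x≈t) (proj₁ (constant-at t))

  H-constant : ∃ N → ∀ x y → H x ~ H y
  H-constant (a₀ , a₀∈N) x y = ~.trans (H≈c x) (~.sym (H≈c y))
    where open From a₀ a₀∈N

-- Residues, and arithmetic modulo a prime.

module CongruenceProperties (n : ℕ) where
  open Congruence n

  scale : ∀ k {a b} → a ≈ b → k * a ≈ k * b
  scale k = *-cong (≈-refl {k})

  pos-≈⇒∣ : ∀ {i j} → i ℕ.≤ j → + i ≈ + j → n ℕ.∣ j ℕ.∸ i
  pos-≈⇒∣ {i} {j} i≤j eq = subst (n ℕ.∣_) (cong ℤ.∣_∣ (trans (ℤ.m-n≡m⊖n j i) (ℤ.⊖-≥ i≤j))) (ℤ.∣⇒∣ᵤ (dvd (≈-sym eq)))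

  ∣⇒pos-≈ : ∀ {i j} → i ℕ.≤ j → n ℕ.∣ j ℕ.∸ i → + i ≈ + j
  ∣⇒pos-≈ {i} {j} i≤j n∣ = ≈-sym (mod (ℤ.∣ᵤ⇒∣ (subst (n ℕ.∣_)
    (sym (cong ℤ.∣_∣ (trans (ℤ.m-n≡m⊖n j i) (ℤ.⊖-≥ i≤j)))) n∣)))

  pos-injective : ∀ {i j} → i ℕ.≤ j → j ℕ.< n → + i ≈ + j → i ≡ j
  pos-injective {i} {j} i≤j j<n eq with j ℕ.∸ i in d≡ | pos-≈⇒∣ i≤j eq
  ... | zero  | _ = ℕ.≤-antisym i≤j (ℕ.m∸n≡0⇒m≤n d≡)
  ... | suc d | n∣d = contradiction
    (ℕ.≤-trans (ℕ.∣⇒≤ n∣d) (ℕ.≤-trans (ℕ.≤-reflexive (sym d≡)) (ℕ.m∸n≤m j i))) (ℕ.<⇒≱ j<n)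

  toℕ-injective : ∀ {i j : Fin n} → + toℕ i ≈ + toℕ j → i ≡ j
  toℕ-injective {i} {j} eq with ℕ.≤-total (toℕ i) (toℕ j)
  ... | inj₁ i≤j = Fin.toℕ-injective (pos-injective i≤j (Fin.toℕ<n j) eq)
  ... | inj₂ j≤i = sym (Fin.toℕ-injective (pos-injective j≤i (Fin.toℕ<n i) (≈-sym eq)))

  pos≉0 : ∀ {k} → 0 ℕ.< k → k ℕ.< n → ¬ + k ≈ 0ℤ
  pos≉0 0<k k<n k≈0 = ℕ.<⇒≢ 0<k (pos-injective z≤n k<n (≈-sym k≈0))

  residue : .{{_ : NonZero n}} → ∀ a → ∃ λ (i : Fin n) → + toℕ i ≈ a
  residue a = Fin.fromℕ< r<n , ≈-trans (≡⇒≈ (cong +_ (Fin.toℕ-fromℕ< r<n)))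
    (≈-sym (mod (ℤ.divides (a ℤ./ℕ n) (trans (cong (_- r) (ℤ.a≡a%ℕn+[a/ℕn]*n a n)) (eq r (a ℤ./ℕ n) (+ n))))))
    where
    r = + (a ℤ.%ℕ n)
    r<n = ℤ.n%ℕd<d a n
    eq : ∀ r q n → r + q * n - r ≡ q * n
    eq = solve-∀

module PrimeField {p : ℕ} (p-prime : Prime p) where
  open Congruence p
  open CongruenceProperties p

  integral : ∀ a b → a * b ≈ 0ℤ → a ≈ 0ℤ ⊎ b ≈ 0ℤ
  integral a b ab≈0 with euclidsLemma ℤ.∣ a ∣ ℤ.∣ b ∣ p-prime
    (subst (p ℕ.∣_) (trans (cong ℤ.∣_∣ (ℤ.+-identityʳ (a * b))) (ℤ.abs-* a b)) (ℤ.∣⇒∣ᵤ (dvd ab≈0)))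
  ... | inj₁ p∣a = inj₁ (mod (ℤ.∣ᵤ⇒∣ (subst (p ℕ.∣_) (cong ℤ.∣_∣ (sym (ℤ.+-identityʳ a))) p∣a)))
  ... | inj₂ p∣b = inj₂ (mod (ℤ.∣ᵤ⇒∣ (subst (p ℕ.∣_) (cong ℤ.∣_∣ (sym (ℤ.+-identityʳ b))) p∣b)))

  *-cancelˡ : ∀ c {a b} → ¬ c ≈ 0ℤ → c * a ≈ c * b → a ≈ b
  *-cancelˡ c {a} {b} c≉0 eq =
    [ (λ c≈0 → contradiction c≈0 c≉0) , (λ a-b≈0 → combine₁ 1ℤ a-b≈0 (unzero a b)) ]′
      (integral c (a - b) (combine₁ 1ℤ eq (distrib c a b)))
    where
    distrib : ∀ c a b → c * (a - b) - 0ℤ ≡ 1ℤ * (c * a - c * b)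
    distrib = solve-∀
    unzero : ∀ a b → a - b ≡ 1ℤ * (a - b - 0ℤ)
    unzero = solve-∀

  invert : ∀ t → Bézout.Identity 1 p t → ∃ λ u → + t * u ≈ 1ℤ
  invert t (Bézout.+- u v eq) = - + v , combine₁ (- + u) n≈0
    (trans (lhs (+ t) (+ v)) (trans (cong (λ w → - w) eq′) (rhs (+ u) (+ p))))
    where
    eq′ : 1ℤ + + v * + t ≡ + u * + p
    eq′ = trans (cong (λ w → 1ℤ + w) (sym (ℤ.pos-* v t))) (trans (cong +_ eq) (ℤ.pos-* u p))
    lhs : ∀ t v → t * - v - 1ℤ ≡ - (1ℤ + v * t)
    lhs = solve-∀
    rhs : ∀ u p → - (u * p) ≡ - u * (p - 0ℤ)
    rhs = solve-∀
  invert t (Bézout.-+ u v eq) = + v , combine₁ (+ u) n≈0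
    (trans (lhs (+ t) (+ v)) (trans (cong (λ w → w - 1ℤ) (sym eq′)) (rhs (+ u) (+ p))))
    where
    eq′ : 1ℤ + + u * + p ≡ + v * + t
    eq′ = trans (cong (λ w → 1ℤ + w) (sym (ℤ.pos-* u p))) (trans (cong +_ eq) (ℤ.pos-* v t))
    lhs : ∀ t v → t * v - 1ℤ ≡ v * t - 1ℤ
    lhs = solve-∀
    rhs : ∀ u p → 1ℤ + u * p - 1ℤ ≡ u * (p - 0ℤ)
    rhs = solve-∀

  solution : .{{_ : NonZero p}} → ∀ c z → ¬ c ≈ 0ℤ → ∃ λ x → c * x ≈ z
  solution c z c≉0 = proj₁ inverse * z , combine₂ (proj₁ inverse * z) z (≈-sym t≈c) (proj₂ inverse)
      (eq c (+ t) (proj₁ inverse) z)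
    where
    t = toℕ (proj₁ (residue c))
    t≈c : + t ≈ c
    t≈c = proj₂ (residue c)
    t≢0 : ¬ t ≡ 0
    t≢0 t≡0 = c≉0 (≈-trans (≈-sym t≈c) (≡⇒≈ (cong +_ t≡0)))
    coprime : ℕ.Coprime p t
    coprime = ℕ.prime⇒coprime p-prime {{ℕ.≢-nonZero t≢0}} (Fin.toℕ<n (proj₁ (residue c)))
    inverse : ∃ λ u → + t * u ≈ 1ℤ
    inverse = invert t (ℕ.coprime-Bézout coprime)
    eq : ∀ c t u z → c * (u * z) - z ≡ u * z * (c - t) + z * (t * u - 1ℤ)
    eq = solve-∀

-- Finite products and Gauss's lemma for - 2.

∏ : ℕ → (ℕ → ℤ) → ℤ
∏ zero    f = 1ℤ
∏ (suc k) f = f k * ∏ k f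

∏-cong : ∀ k {f g} → (∀ {j} → j ℕ.< k → f j ≡ g j) → ∏ k f ≡ ∏ k g
∏-cong zero    eq = refl
∏-cong (suc k) eq = cong₂ _*_ (eq ℕ.≤-refl) (∏-cong k (λ j<k → eq (ℕ.m<n⇒m<1+n j<k)))

∏-scale : ∀ k c f → ∏ k (λ j → c * f j) ≡ c ^ k * ∏ k f
∏-scale zero    c f = refl
∏-scale (suc k) c f = trans (cong (c * f k *_) (∏-scale k c f)) (eq c (f k) (c ^ k) (∏ k f))
  where
  eq : ∀ c x y z → c * x * (y * z) ≡ c * y * (x * z)
  eq = solve-∀

∏-+ : ∀ i j f → ∏ (i ℕ.+ j) f ≡ ∏ i (λ k → f (k ℕ.+ j)) * ∏ j f
∏-+ zero    j f = sym (ℤ.*-identityˡ (∏ j f))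
∏-+ (suc i) j f = trans (cong (f (i ℕ.+ j) *_) (∏-+ i j f)) (sym (ℤ.*-assoc (f (i ℕ.+ j)) _ _))

∏-suc : ∀ k f → ∏ (suc k) f ≡ ∏ k (λ j → f (suc j)) * f 0
∏-suc zero    f = ℤ.*-comm (f 0) 1ℤ
∏-suc (suc k) f = trans (cong (f (suc k) *_) (∏-suc k f)) (sym (ℤ.*-assoc (f (suc k)) _ (f 0)))

∏-reverse : ∀ k f → ∏ k (λ j → f (k ℕ.∸ suc j)) ≡ ∏ k f
∏-reverse zero    f = refl
∏-reverse (suc k) f = begin
  f (k ℕ.∸ k) * ∏ k (λ j → f (k ℕ.∸ j))
    ≡⟨ cong₂ _*_ (cong f (ℕ.n∸n≡0 k)) (∏-cong k λ j<k → cong f (ℕ.+-∸-assoc 1 {k} j<k)) ⟩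
  f 0 * ∏ k (λ j → f (suc (k ℕ.∸ suc j)))           ≡⟨ cong (f 0 *_) (∏-reverse k (λ j → f (suc j))) ⟩
  f 0 * ∏ k (λ j → f (suc j))                       ≡⟨ ℤ.*-comm (f 0) _ ⟩
  ∏ k (λ j → f (suc j)) * f 0                       ≡⟨ ∏-suc k f ⟨
  ∏ (suc k) f                                       ∎
  where open ≡-Reasoning

∏-even-odd : ∀ k f → ∏ (k ℕ.+ k) f ≡ ∏ k (λ j → f (j ℕ.+ j)) * ∏ k (λ j → f (suc (j ℕ.+ j)))
∏-even-odd zero    f = refl
∏-even-odd (suc k) f = begin
  ∏ (suc k ℕ.+ suc k) f                             ≡⟨ cong (λ i → ∏ i f) (ℕ.+-suc (suc k) k) ⟩
  b * (a * ∏ (k ℕ.+ k) f)                           ≡⟨ cong (λ z → b * (a * z)) (∏-even-odd k f) ⟩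
  b * (a * (x * y))                                 ≡⟨ eq b a x y ⟩
  (a * x) * (b * y)                                 ∎
  where
  open ≡-Reasoning
  a = f (k ℕ.+ k)
  b = f (suc (k ℕ.+ k))
  x = ∏ k (λ j → f (j ℕ.+ j))
  y = ∏ k (λ j → f (suc (j ℕ.+ j)))
  eq : ∀ b a x y → b * (a * (x * y)) ≡ (a * x) * (b * y)
  eq = solve-∀

sign² : ∀ l → (- 1ℤ) ^ (l ℕ.+ l) ≡ 1ℤ
sign² zero    = refl
sign² (suc l) = trans (cong ((- 1ℤ) ^_) (ℕ.+-suc (suc l) l)) (trans (eq ((- 1ℤ) ^ (l ℕ.+ l))) (sign² l))
  where
  eq : ∀ x → - 1ℤ * (- 1ℤ * x) ≡ x
  eq = solve-∀

-- Gauss's lemma for - 2: the residues of - 2, - 4, …, - 2 q are, up to sign, the even numbers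
-- below q, with 2 l sign changes, followed by the odd numbers in reverse.
module MinusTwo {p : ℕ} (p-prime : Prime p) (l s : ℕ)
  (p≡ : p ≡ suc ((s ℕ.+ (l ℕ.+ l)) ℕ.+ (s ℕ.+ (l ℕ.+ l))))
  (s-cases : s ≡ l ℕ.+ l ⊎ s ≡ suc (l ℕ.+ l)) where

  open Congruence p
  open CongruenceProperties p
  open PrimeField p-prime

  -- Here q = (p - 1) / 2, with p = 8 l + 1 or 8 l + 3, and 2 k ≤ q exactly when k ≤ `r`. For such k
  -- the product - 2 k is minus an even number; for larger k ≤ q it is congruent to the odd number p
  -- - 2 k. As `r` is even, the signs cancel.
  r q : ℕ
  r = l ℕ.+ l
  q = s ℕ.+ r

  private
    f : ℕ → ℤ
    f k = + suc k

    odds evens : ℕ → ℤ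
    odds j  = f (j ℕ.+ j)
    evens j = f (suc (j ℕ.+ j))

  ∏-cong-≈ : ∀ k {f g} → (∀ {j} → j ℕ.< k → f j ≈ g j) → ∏ k f ≈ ∏ k g
  ∏-cong-≈ zero    eq = ≈-refl
  ∏-cong-≈ (suc k) eq = *-cong (eq ℕ.≤-refl) (∏-cong-≈ k (λ j<k → eq (ℕ.m<n⇒m<1+n j<k)))

  lower-half : ∏ r (λ k → - + 2 * f k) ≡ ∏ r evens
  lower-half = begin
    ∏ r (λ k → - + 2 * f k)            ≡⟨ ∏-cong r (λ {k} _ → eq (+ k)) ⟩
    ∏ r (λ k → - 1ℤ * evens k)         ≡⟨ ∏-scale r (- 1ℤ) evens ⟩
    (- 1ℤ) ^ r * ∏ r evens             ≡⟨ cong (_* ∏ r evens) (sign² l) ⟩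
    1ℤ * ∏ r evens                     ≡⟨ ℤ.*-identityˡ _ ⟩
    ∏ r evens                          ∎
    where
    open ≡-Reasoning
    eq : ∀ k → - + 2 * (1ℤ + k) ≡ - 1ℤ * (1ℤ + (1ℤ + (k + k)))
    eq = solve-∀

  upper-half : ∏ s (λ k → - + 2 * f (k ℕ.+ r)) ≈ ∏ s odds
  upper-half = ≈-trans (∏-cong-≈ s reflect) (≡⇒≈ (∏-reverse s odds))
    where
    reflect : ∀ {j} → j ℕ.< s → - + 2 * f (j ℕ.+ r) ≈ odds (s ℕ.∸ suc j)
    reflect {j} j<s = combine₁ (- 1ℤ) n≈0 (trans
      (eq (+ j) (+ (s ℕ.∸ suc j)) (+ r))
      (cong (λ z → - 1ℤ * (z - 0ℤ)) (sym p≡′)))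
      where
      eq : ∀ j i r → - + 2 * (1ℤ + (j + r)) - (1ℤ + (i + i)) ≡
           - 1ℤ * (1ℤ + ((i + (1ℤ + j) + r) + (i + (1ℤ + j) + r)) - 0ℤ)
      eq = solve-∀
      p≡′ : + p ≡ 1ℤ + ((+ (s ℕ.∸ suc j) + (1ℤ + + j) + + r) + (+ (s ℕ.∸ suc j) + (1ℤ + + j) + + r))
      p≡′ = cong +_ (trans p≡ (cong (λ s → suc ((s ℕ.+ r) ℕ.+ (s ℕ.+ r))) (sym (ℕ.m∸n+n≡m j<s))))

  factorial : ∏ q f ≡ ∏ s odds * ∏ r evens
  factorial = [ (λ { refl → ∏-even-odd r f })
              , (λ { refl → trans (cong (f (r ℕ.+ r) *_) (∏-even-odd r f))
                              (sym (ℤ.*-assoc (f (r ℕ.+ r)) (∏ r odds) (∏ r evens))) })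
              ]′ s-cases

  fixes-factorial : (- + 2) ^ q * ∏ q f ≈ ∏ q f
  fixes-factorial = begin
    (- + 2) ^ q * ∏ q f                                                ≡⟨ ∏-scale q (- + 2) f ⟨
    ∏ q (λ k → - + 2 * f k)                                            ≡⟨ ∏-+ s r (λ k → - + 2 * f k) ⟩
    ∏ s (λ k → - + 2 * f (k ℕ.+ r)) * ∏ r (λ k → - + 2 * f k)          ≈⟨ *-cong upper-half (≡⇒≈ lower-half) ⟩
    ∏ s odds * ∏ r evens                                               ≡⟨ factorial ⟨
    ∏ q f                                                              ∎
    where open SetoidReasoning ≈-setoid

  factorial≉0 : ∀ k → k ℕ.< p → ¬ ∏ k f ≈ 0ℤ
  factorial≉0 zero    0<p 1≈0 = pos≉0 (s≤s z≤n) (ℕ.nonTrivial⇒n>1 p {{prime⇒nonTrivial p-prime}}) 1≈0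
  factorial≉0 (suc k) k<p eq with integral (f k) (∏ k f) eq
  ... | inj₁ f≈0 = pos≉0 (s≤s z≤n) k<p f≈0
  ... | inj₂ ∏≈0 = factorial≉0 k (ℕ.<-trans (ℕ.n<1+n k) k<p) ∏≈0

  -2^q≈1 : (- + 2) ^ q ≈ 1ℤ
  -2^q≈1 = *-cancelˡ (∏ q f) (factorial≉0 q (ℕ.≤-trans (s≤s (ℕ.m≤m+n q q)) (ℕ.≤-reflexive (sym p≡))))
    (combine₁ 1ℤ fixes-factorial (eq (∏ q f) ((- + 2) ^ q)))
    where
    eq : ∀ f g → f * g - f * 1ℤ ≡ 1ℤ * (g * f - f)
    eq = solve-∀

-- Left powers and instruction sequences in loops.

private
  variable
    c ℓ c′ ℓ′ : Level

prime⇒coprime′ : ∀ {p d} → Prime p → ¬ p ℕ.∣ d → ℕ.Coprime p d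
prime⇒coprime′ p-prime p∤d (q∣p , q∣d) with prime⇒irreducible p-prime q∣p
... | inj₁ q≡1 = q≡1
... | inj₂ refl = contradiction q∣d p∤d

module LeftPower (L : Loop c ℓ) where
  open Loop L renaming (refl to ≈-refl; sym to ≈-sym; trans to ≈-trans) hiding (reflexive)
  open QuasigroupProperties quasigroup using (cancelˡ)
  open SetoidReasoning setoid

  act : Carrier → ℕ → Carrier → Carrier
  act y zero    z = z
  act y (suc k) z = y ∙ act y k z

  power : Carrier → ℕ → Carrier
  power y k = act y k ε

  act-cong : ∀ {y y′ z z′} k → y ≈ y′ → z ≈ z′ → act y k z ≈ act y′ k z′
  act-cong zero    y≈y′ z≈z′ = z≈z′
  act-cong (suc k) y≈y′ z≈z′ = ∙-cong y≈y′ (act-cong k y≈y′ z≈z′)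

  power-ε : ∀ k → power ε k ≈ ε
  power-ε zero    = ≈-refl
  power-ε (suc k) = ≈-trans (identityˡ _) (power-ε k)

  act-+ : ∀ y i j z → act y (i ℕ.+ j) z ≡ act y i (act y j z)
  act-+ y zero    j z = refl
  act-+ y (suc i) j z = cong (y ∙_) (act-+ y i j z)

  power-+ : ∀ y i j → power y j ≈ ε → power y (i ℕ.+ j) ≈ power y i
  power-+ y i j eq rewrite act-+ y i j ε = act-cong i ≈-refl eq

  act-cancel : ∀ y k {z z′} → act y k z ≈ act y k z′ → z ≈ z′
  act-cancel y zero    eq = eq
  act-cancel y (suc k) eq = act-cancel y k (cancelˡ y _ _ eq)

  power-* : ∀ y k d → power y d ≈ ε → power y (k ℕ.* d) ≈ ε
  power-* y zero    d eq = ≈-refl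
  power-* y (suc k) d eq = ≈-trans (power-+ y d (k ℕ.* d) (power-* y k d eq)) eq

  power-% : ∀ y k d .{{_ : NonZero d}} → power y d ≈ ε → power y k ≈ power y (k ℕ.% d)
  power-% y k d eq = begin
    power y k                                  ≡⟨ cong (power y) (ℕ.m≡m%n+[m/n]*n k d) ⟩
    power y (k ℕ.% d ℕ.+ k ℕ./ d ℕ.* d)        ≈⟨ power-+ y (k ℕ.% d) _ (power-* y (k ℕ./ d) d eq) ⟩
    power y (k ℕ.% d)                          ∎

  power-∸ : ∀ y {i j} → i ℕ.≤ j → power y i ≈ power y j → power y (j ℕ.∸ i) ≈ ε
  power-∸ y {i} {j} i≤j eq = ≈-sym (act-cancel y i (begin
    power y i                        ≈⟨ eq ⟩
    power y j                        ≡⟨ cong (power y) (ℕ.m+[n∸m]≡n i≤j) ⟨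
    power y (i ℕ.+ (j ℕ.∸ i))        ≡⟨ act-+ y i (j ℕ.∸ i) ε ⟩
    act y i (power y (j ℕ.∸ i))      ∎))

  coprime-powers : ∀ y {k d} → power y k ≈ ε → power y d ≈ ε → ℕ.Coprime k d → y ≈ ε
  coprime-powers y {k} {d} yᵏ≈ε yᵈ≈ε coprime with ℕ.coprime-Bézout coprime
  ... | Bézout.+- u v eq = begin
    y                          ≈⟨ identityʳ y ⟨
    power y 1                  ≈⟨ power-+ y 1 (v ℕ.* d) (power-* y v d yᵈ≈ε) ⟨
    power y (1 ℕ.+ v ℕ.* d)    ≡⟨ cong (power y) eq ⟩
    power y (u ℕ.* k)          ≈⟨ power-* y u k yᵏ≈ε ⟩
    ε                          ∎
  ... | Bézout.-+ u v eq = begin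
    y                          ≈⟨ identityʳ y ⟨
    power y 1                  ≈⟨ power-+ y 1 (u ℕ.* k) (power-* y u k yᵏ≈ε) ⟨
    power y (1 ℕ.+ u ℕ.* k)    ≡⟨ cong (power y) eq ⟩
    power y (v ℕ.* d)          ≈⟨ power-* y v d yᵈ≈ε ⟩
    ε                          ∎

  power-injective : ∀ {p} → Prime p → ∀ y → ¬ (y ≈ ε) → power y p ≈ ε →
                    ∀ {i j} → i ℕ.≤ j → j ℕ.< p → power y i ≈ power y j → i ≡ j
  power-injective p-prime y y≉ε yᵖ≈ε {i} {j} i≤j j<p eq with ℕ.m≤n⇒m<n∨m≡n i≤j
  ... | inj₂ i≡j = i≡j
  ... | inj₁ i<j = contradiction (coprime-powers y yᵖ≈ε (power-∸ y i≤j eq) coprime) y≉ε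
    where
    instance
      j∸i≢0 : NonZero (j ℕ.∸ i)
      j∸i≢0 = ℕ.>-nonZero (ℕ.m<n⇒0<n∸m i<j)
    coprime = ℕ.prime⇒coprime p-prime (ℕ.≤-<-trans (ℕ.m∸n≤m j i) j<p)

-- An instruction acts on y as the left power e applied to yⁱ yʲ; the condition says that in a
-- group of exponent p it is injective.
record Instruction (p : ℕ) : Set where
  field
    e i j : ℕ
    p∤    : ¬ p ℕ.∣ e ℕ.+ (i ℕ.+ j)

module Run (L : Loop c ℓ) where
  open Loop L renaming (refl to ≈-refl; sym to ≈-sym; trans to ≈-trans) hiding (reflexive)
  open LeftPower L
  open SetoidReasoning setoid

  apply : ∀ {p} → Instruction p → Carrier → Carrier
  apply I y = act y e (power y i ∙ power y j)
    where open Instruction I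

  run : ∀ {p} → List (Instruction p) → Carrier → Carrier
  run []       y = y
  run (I ∷ Is) y = apply I (run Is y)

  apply-cong : ∀ {p} (I : Instruction p) {y z} → y ≈ z → apply I y ≈ apply I z
  apply-cong I y≈z = act-cong e y≈z (∙-cong (act-cong i y≈z ≈-refl) (act-cong j y≈z ≈-refl))
    where open Instruction I

  run-cong : ∀ {p} (Is : List (Instruction p)) {y z} → y ≈ z → run Is y ≈ run Is z
  run-cong []       y≈z = y≈z
  run-cong (I ∷ Is) y≈z = apply-cong I (run-cong Is y≈z)

  apply-ε : ∀ {p} (I : Instruction p) → apply I ε ≈ ε
  apply-ε I = ≈-trans (act-cong e ≈-refl (≈-trans (∙-cong (power-ε i) (power-ε j)) (identityˡ ε))) (power-ε e)
    where open Instruction I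

  module _ (assoc : IsGroup L) where

    power-act : ∀ y k z → power y k ∙ z ≈ act y k z
    power-act y zero    z = identityˡ z
    power-act y (suc k) z = ≈-trans (assoc y (power y k) z) (∙-cong ≈-refl (power-act y k z))

    apply-group : ∀ {p} (I : Instruction p) y →
                  apply I y ≈ power y (Instruction.e I ℕ.+ (Instruction.i I ℕ.+ Instruction.j I))
    apply-group I y = begin
      act y e (power y i ∙ power y j)       ≈⟨ act-cong e ≈-refl (power-act y i (power y j)) ⟩
      act y e (act y i (power y j))         ≡⟨ cong (act y e) (act-+ y i j ε) ⟨
      act y e (power y (i ℕ.+ j))           ≡⟨ act-+ y e (i ℕ.+ j) ε ⟨
      power y (e ℕ.+ (i ℕ.+ j))             ∎
      where open Instruction I

    run-group : ∀ {p} → Prime p → (∀ y → power y p ≈ ε) →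
                (Is : List (Instruction p)) → ∀ y → run Is y ≈ ε → y ≈ ε
    run-group p-prime exponent []       y eq = eq
    run-group p-prime exponent (I ∷ Is) y eq = run-group p-prime exponent Is y
      (coprime-powers z (exponent z) (≈-trans (≈-sym (apply-group I z)) eq)
        (prime⇒coprime′ p-prime (Instruction.p∤ I)))
      where z = run Is y

-- Replaces the missing constant: in a loop the left quotient of any element by itself is the
-- identity.
e-term : Term
e-term = var 0 ⧵ var 0

actᵗ : Term → ℕ → Term → Term
actᵗ s zero    t = t
actᵗ s (suc k) t = s · actᵗ s k t

applyᵗ : ∀ {p} → Instruction p → Term → Term
applyᵗ I s = actᵗ s e (actᵗ s i e-term · actᵗ s j e-term)
  where open Instruction I

runᵗ : ∀ {p} → List (Instruction p) → Term
runᵗ []       = var 0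
runᵗ (I ∷ Is) = applyᵗ I (runᵗ Is)

module _ (L : Loop c ℓ) (ρ : ℕ → Loop.Carrier L) where
  open Loop L renaming (refl to ≈-refl; sym to ≈-sym; trans to ≈-trans) hiding (reflexive)
  open LoopProperties L using (x\\x≈ε)
  open LeftPower L
  open Run L

  eval-act : ∀ s k t {z} → eval L ρ t ≈ z → eval L ρ (actᵗ s k t) ≈ act (eval L ρ s) k z
  eval-act s zero    t eq = eq
  eval-act s (suc k) t eq = ∙-cong ≈-refl (eval-act s k t eq)

  eval-power : ∀ s k → eval L ρ (actᵗ s k e-term) ≈ power (eval L ρ s) k
  eval-power s k = eval-act s k e-term (x\\x≈ε (ρ 0))

  eval-apply : ∀ {p} (I : Instruction p) s → eval L ρ (applyᵗ I s) ≈ apply I (eval L ρ s)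
  eval-apply I s = eval-act s e _ (∙-cong (eval-power s i) (eval-power s j))
    where open Instruction I

  eval-run : ∀ {p} (Is : List (Instruction p)) → eval L ρ (runᵗ Is) ≈ run Is (ρ 0)
  eval-run []       = ≈-refl
  eval-run (I ∷ Is) = ≈-trans (eval-apply I (runᵗ Is)) (apply-cong I (eval-run Is))

-- Terms and identities in isotopic loops.

-- In the principal isotope (x / b)(a \ y) the terms of a loop become terms with two more
-- variables, a = var 0 and b = var 1.
isotope : Term → Term
isotope (var i) = var (suc (suc i))
isotope (s · t) = (isotope s ⧸ var 1) · (var 0 ⧵ isotope t)
isotope (s ⧵ t) = var 0 · ((isotope s ⧸ var 1) ⧵ isotope t)
isotope (s ⧸ t) = (isotope s ⧸ (var 0 ⧵ isotope t)) · var 1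

module _ (L : Loop c ℓ) (L′ : Loop c′ ℓ′) where
  private
    module L  = Loop L
    module L′ = Loop L′

  -- Compatibility with products suffices: quotients are unique solutions of equations, so a map
  -- that respects products respects them as well.
  eval-isotope : (γ : L.Carrier → L′.Carrier) → (∀ {x y} → x L.≈ y → γ x L′.≈ γ y) →
    ∀ ρ → (∀ x y → γ ((x L.// ρ 1) L.∙ (ρ 0 L.\\ y)) L′.≈ γ x L′.∙ γ y) →
    ∀ ρ′ → (∀ i → γ (ρ (suc (suc i))) L′.≈ ρ′ i) →
    ∀ t → γ (eval L ρ (isotope t)) L′.≈ eval L′ ρ′ t
  eval-isotope γ γ-cong ρ hom ρ′ vars = go
    where
    open QuasigroupProperties L′.quasigroup using (y≈x\\z; x≈z//y)
    go : ∀ t → γ (eval L ρ (isotope t)) L′.≈ eval L′ ρ′ t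
    go (var i) = vars i
    go (s · t) = L′.trans (hom _ _) (L′.∙-cong (go s) (go t))
    go (s ⧵ t) = L′.trans (y≈x\\z (γ x) (γ z) (γ y) (L′.trans (L′.sym (hom x z)) (γ-cong
      (L.trans (L.∙-cong L.refl (L.leftDividesʳ (ρ 0) _)) (L.leftDividesˡ (x L.// ρ 1) y)))))
      (L′.\\-cong (go s) (go t))
      where
      x = eval L ρ (isotope s)
      y = eval L ρ (isotope t)
      z = ρ 0 L.∙ ((x L.// ρ 1) L.\\ y)
    go (s ⧸ t) = L′.trans (x≈z//y (γ z) (γ y) (γ x) (L′.trans (L′.sym (hom z y)) (γ-cong
      (L.trans (L.∙-cong (L.rightDividesʳ (ρ 1) _) L.refl) (L.rightDividesˡ (ρ 0 L.\\ y) x)))))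
      (L′.//-cong (go s) (go t))
      where
      x = eval L ρ (isotope s)
      y = eval L ρ (isotope t)
      z = (x L.// (ρ 0 L.\\ y)) L.∙ ρ 1

module _ {L L′ : Loop c ℓ} (I : Isotopism L L′) where
  private
    module L  = Loop L
    module L′ = Loop L′
    module α = Bijection (Isotopism.α I)
    module β = Bijection (Isotopism.β I)
    module γ = Bijection (Isotopism.γ I)

  -- With the preimages of the identity under `α` and `β` as parameters, `γ` becomes an isomorphism
  -- from a principal isotope of `L` onto `L′`.
  satisfies-isotopic : ∀ s t → Satisfies L (isotope s) (isotope t) → Satisfies L′ s t
  satisfies-isotopic s t sat ρ′ =
    L′.trans (L′.sym (eval′ s)) (L′.trans (γ.cong (sat ρ)) (eval′ t))
    where
    ρ : ℕ → L.Carrier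
    ρ 0 = proj₁ (α.strictlySurjective L′.ε)
    ρ 1 = proj₁ (β.strictlySurjective L′.ε)
    ρ (suc (suc i)) = proj₁ (γ.strictlySurjective (ρ′ i))
    open SetoidReasoning L′.setoid
    hom : ∀ x y → γ.to ((x L.// ρ 1) L.∙ (ρ 0 L.\\ y)) L′.≈ γ.to x L′.∙ γ.to y
    hom x y = begin
      γ.to ((x L.// ρ 1) L.∙ (ρ 0 L.\\ y))          ≈⟨ Isotopism.isotopic I _ _ ⟨
      α.to (x L.// ρ 1) L′.∙ β.to (ρ 0 L.\\ y)      ≈⟨ L′.∙-cong (L′.identityʳ _) (L′.identityˡ _) ⟨
      (α.to (x L.// ρ 1) L′.∙ L′.ε) L′.∙ (L′.ε L′.∙ β.to (ρ 0 L.\\ y))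
        ≈⟨ L′.∙-cong (L′.∙-cong L′.refl (proj₂ (β.strictlySurjective L′.ε)))
                     (L′.∙-cong (proj₂ (α.strictlySurjective L′.ε)) L′.refl) ⟨
      (α.to (x L.// ρ 1) L′.∙ β.to (ρ 1)) L′.∙ (α.to (ρ 0) L′.∙ β.to (ρ 0 L.\\ y))
        ≈⟨ L′.∙-cong (Isotopism.isotopic I _ _) (Isotopism.isotopic I _ _) ⟩
      γ.to ((x L.// ρ 1) L.∙ ρ 1) L′.∙ γ.to (ρ 0 L.∙ (ρ 0 L.\\ y))
        ≈⟨ L′.∙-cong (γ.cong (L.rightDividesˡ (ρ 1) x)) (γ.cong (L.leftDividesˡ (ρ 0) y)) ⟩
      γ.to x L′.∙ γ.to y                            ∎
    eval′ = eval-isotope L L′ γ.to γ.cong ρ hom ρ′ (λ i → proj₂ (γ.strictlySurjective (ρ′ i)))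

liftLoop : ∀ c ℓ → Loop 0ℓ 0ℓ → Loop c ℓ
liftLoop c ℓ L = record
  { Carrier = Lift c L.Carrier
  ; _≈_     = λ x y → Lift ℓ (lower x L.≈ lower y)
  ; _∙_     = λ x y → lift (lower x L.∙ lower y)
  ; _\\_    = λ x y → lift (lower x L.\\ lower y)
  ; _//_    = λ x y → lift (lower x L.// lower y)
  ; ε       = lift L.ε
  ; isLoop  = record
    { isQuasigroup = record
      { isMagma = record
        { isEquivalence = record
          { refl  = lift L.refl
          ; sym   = λ p → lift (L.sym (lower p))
          ; trans = λ p q → lift (L.trans (lower p) (lower q))
          }
        ; ∙-cong = λ p q → lift (L.∙-cong (lower p) (lower q))
        }
      ; \\-cong = λ p q → lift (L.\\-cong (lower p) (lower q))
      ; //-cong = λ p q → lift (L.//-cong (lower p) (lower q))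
      ; leftDivides = (λ x y → lift (L.leftDividesˡ (lower x) (lower y)))
                    , (λ x y → lift (L.leftDividesʳ (lower x) (lower y)))
      ; rightDivides = (λ x y → lift (L.rightDividesˡ (lower x) (lower y)))
                     , (λ x y → lift (L.rightDividesʳ (lower x) (lower y)))
      }
    ; identity = (λ x → lift (L.identityˡ (lower x))) , (λ x → lift (L.identityʳ (lower x)))
    }
  }
  where module L = Loop L

eval-lift : ∀ (L : Loop 0ℓ 0ℓ) ρ t → lower (eval (liftLoop c ℓ L) ρ t) ≡ eval L (λ i → lower (ρ i)) t
eval-lift L ρ (var i) = refl
eval-lift L ρ (s · t) = cong₂ (Loop._∙_ L) (eval-lift L ρ s) (eval-lift L ρ t)
eval-lift L ρ (s ⧵ t) = cong₂ (Loop._\\_ L) (eval-lift L ρ s) (eval-lift L ρ t)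
eval-lift L ρ (s ⧸ t) = cong₂ (Loop._//_ L) (eval-lift L ρ s) (eval-lift L ρ t)

-- An injective homomorphism to ℤ/p.
record Logarithm (p : ℕ) (L : Loop 0ℓ 0ℓ) : Set where
  open Loop L using (Carrier; _∙_) renaming (_≈_ to _≈ᴸ_)
  open Congruence p
  field
    log           : Carrier → ℤ
    log-cong      : ∀ {x y} → x ≈ᴸ y → log x ≈ log y
    log-injective : ∀ {x y} → log x ≈ log y → x ≈ᴸ y
    log-∙         : ∀ x y → log (x ∙ y) ≈ log x + log y

-- Principal isotopes of a quasigroup.

module PrincipalIsotope (Q : Quasigroup 0ℓ 0ℓ) where
  open Quasigroup Q renaming (refl to ≈-refl; sym to ≈-sym; trans to ≈-trans) hiding (reflexive)

  principalIsotope : Carrier → Carrier → Loop 0ℓ 0ℓ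
  principalIsotope a b = record
    { Carrier = Carrier
    ; _≈_     = _≈_
    ; _∙_     = λ x y → (x // b) ∙ (a \\ y)
    ; _\\_    = λ x y → a ∙ ((x // b) \\ y)
    ; _//_    = λ x y → (x // (a \\ y)) ∙ b
    ; ε       = a ∙ b
    ; isLoop  = record
      { isQuasigroup = record
        { isMagma = record
          { isEquivalence = isEquivalence
          ; ∙-cong = λ p q → ∙-cong (//-cong p ≈-refl) (\\-cong ≈-refl q)
          }
        ; \\-cong = λ p q → ∙-cong ≈-refl (\\-cong (//-cong p ≈-refl) q)
        ; //-cong = λ p q → ∙-cong (//-cong p (\\-cong ≈-refl q)) ≈-refl
        ; leftDivides =
            (λ x y → ≈-trans (∙-cong ≈-refl (leftDividesʳ a _)) (leftDividesˡ (x // b) y))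
          , (λ x y → ≈-trans (∙-cong ≈-refl (leftDividesʳ (x // b) _)) (leftDividesˡ a y))
        ; rightDivides =
            (λ x y → ≈-trans (∙-cong (rightDividesʳ b _) ≈-refl) (rightDividesˡ (a \\ x) y))
          , (λ x y → ≈-trans (∙-cong (rightDividesʳ (a \\ x) _) ≈-refl) (rightDividesˡ b y))
        }
      ; identity = (λ x → ≈-trans (∙-cong (rightDividesʳ b a) ≈-refl) (leftDividesˡ a x))
                 , (λ x → ≈-trans (∙-cong ≈-refl (leftDividesʳ a b)) (rightDividesˡ b x))
      }
    }

  module Powers (a b : Carrier) = LeftPower (principalIsotope a b)

  eval-cong : ∀ {a a′ b b′ ρ ρ′} → a ≈ a′ → b ≈ b′ → (∀ i → ρ i ≈ ρ′ i) → ∀ t →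
              eval (principalIsotope a b) ρ t ≈ eval (principalIsotope a′ b′) ρ′ t
  eval-cong p q r (var i) = r i
  eval-cong p q r (s · t) = ∙-cong (//-cong (eval-cong p q r s) q) (\\-cong p (eval-cong p q r t))
  eval-cong p q r (s ⧵ t) = ∙-cong p (\\-cong (//-cong (eval-cong p q r s) q) (eval-cong p q r t))
  eval-cong p q r (s ⧸ t) = ∙-cong (//-cong (eval-cong p q r s) (\\-cong p (eval-cong p q r t))) q

  -- Says that `z` and the identity `a ∙ b` lie in one orbit of left multiplication by `y`, without
  -- mention of inverse powers.
  Connected : Set
  Connected = ∀ a b y → ¬ y ≈ a ∙ b → ∀ z → ∃₂ λ i j → Powers.act a b y i z ≈ Powers.power a b y j

  NotCyclic : ℕ → Set
  NotCyclic p = ∀ a b → ¬ Logarithm p (principalIsotope a b)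

  -- Quantifying over all principal isotopes makes the variety isotopically closed, since an
  -- isotope of a principal isotope of Q is again one up to isomorphism.
  IsotopeIdentities : Identities
  IsotopeIdentities s t = ∀ a b → Satisfies (principalIsotope a b) s t

  -- In an isotope of an isotope the inner parameters cancel, which leaves a principal isotope of Q
  -- itself, where the identity is assumed.
  isotope-closed : ∀ s t → IsotopeIdentities s t → IsotopeIdentities (isotope s) (isotope t)
  isotope-closed s t holds a b ρ = ≈-trans (eval′ s) (≈-trans (holds _ _ _) (≈-sym (eval′ t)))
    where
    hom : ∀ x y → (((x // (a \\ ρ 1)) ∙ b) // b) ∙ (a \\ (a ∙ ((ρ 0 // b) \\ y))) ≈
          (x // (a \\ ρ 1)) ∙ ((ρ 0 // b) \\ y)
    hom x y = ∙-cong (rightDividesʳ b _) (leftDividesʳ a _)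
    eval′ = eval-isotope (principalIsotope a b) (principalIsotope (ρ 0 // b) (a \\ ρ 1))
              (λ x → x) (λ eq → eq) ρ hom (λ i → ρ (suc (suc i))) (λ _ → ≈-refl)

-- From a quasigroup of prime order to a Falconer variety.

-- In a group of exponent p every instruction is injective, so an instruction sequence that kills
-- all elements of all principal isotopes of Q gives an identity without non-trivial group models.
module FalconerConstruction
  {p : ℕ} (p-prime : Prime p) (Q : Quasigroup 0ℓ 0ℓ)
  (order : Bijection (≡.setoid (Fin p)) (Quasigroup.setoid Q))
  (connected : PrincipalIsotope.Connected Q)
  (not-cyclic : PrincipalIsotope.NotCyclic Q p)
  where

  open PrincipalIsotope Q
  open Quasigroup Q using (Carrier; _≈_; _∙_; ∙-cong) renaming (refl to ≈-refl; sym to ≈-sym; trans to ≈-trans)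
  open Bijection order using (to; injective; strictlySurjective)

  private instance
    p≢0 : NonZero p
    p≢0 = prime⇒nonZero p-prime

  index : Carrier → Fin p
  index x = proj₁ (strictlySurjective x)

  to-index : ∀ x → to (index x) ≈ x
  to-index x = proj₂ (strictlySurjective x)

  index-cong : ∀ {x y} → x ≈ y → index x ≡ index y
  index-cong {x} {y} x≈y = injective (≈-trans (to-index x) (≈-trans x≈y (≈-sym (to-index y))))

  index-injective : ∀ {x y} → index x ≡ index y → x ≈ y
  index-injective {x} {y} eq = ≈-trans (≈-sym (to-index x)) (≈-trans (Bijection.cong order eq) (to-index y))

  _≈?_ : ∀ x y → Dec (x ≈ y)
  x ≈? y = Dec.map′ index-injective index-cong (index x Fin.≟ index y)

  module _ (a b : Carrier) where
    open LeftPower (principalIsotope a b)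
    open Run (principalIsotope a b)

    period : ∀ y → ∃ λ d → 0 ℕ.< d × d ℕ.≤ p × power y d ≈ a ∙ b
    period y with Fin.pigeonhole (ℕ.n<1+n p) (λ i → index (power y (toℕ i)))
    ... | i , j , i<j , eq = toℕ j ℕ.∸ toℕ i , ℕ.m<n⇒0<n∸m i<j
      , ℕ.≤-trans (ℕ.m∸n≤m (toℕ j) (toℕ i)) (ℕ.s≤s⁻¹ (Fin.toℕ<n j))
      , power-∸ y (ℕ.<⇒≤ i<j) (index-injective eq)

    -- Adding a multiple of the period to `j` raises the exponent above `i`, so that the left power
    -- `i` can be cancelled.
    generated : ∀ y → ¬ y ≈ a ∙ b → ∀ z → ∃ λ k → z ≈ power y k
    generated y y≉ε z with period y | connected a b y y≉ε z
    ... | d@(suc _) , _ , _ , yᵈ≈ε | i , j , eq = k ℕ.∸ i , act-cancel y i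
      (≈-trans eq (≈-trans (≈-sym (power-+ y j (i ℕ.* d) (power-* y i d yᵈ≈ε)))
        (subst (power y k ≈_)
          (trans (cong (power y) (sym (ℕ.m+[n∸m]≡n i≤k))) (act-+ y i (k ℕ.∸ i) (a ∙ b))) ≈-refl)))
      where
      k = j ℕ.+ i ℕ.* d
      i≤k : i ℕ.≤ k
      i≤k = ℕ.≤-trans (ℕ.m≤m*n i d) (ℕ.m≤n+m (i ℕ.* d) j)

    reduced : ∀ y → ¬ y ≈ a ∙ b → ∀ d .{{_ : NonZero d}} → power y d ≈ a ∙ b →
              ∀ z → ∃ λ (k : Fin d) → z ≈ power y (toℕ k)
    reduced y y≉ε d yᵈ≈ε z with generated y y≉ε z
    ... | k , z≈yᵏ = Fin.fromℕ< (ℕ.m%n<n k d) , ≈-trans z≈yᵏ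
      (subst (λ r → power y k ≈ power y r) (sym (Fin.toℕ-fromℕ< (ℕ.m%n<n k d))) (power-% y k d yᵈ≈ε))

    exponent : ∀ y → power y p ≈ a ∙ b
    exponent y with y ≈? (a ∙ b)
    ... | yes y≈ε = ≈-trans (act-cong p y≈ε ≈-refl) (power-ε p)
    ... | no y≉ε with period y
    ...   | d@(suc _) , _ , d≤p , yᵈ≈ε with ℕ.m≤n⇒m<n∨m≡n d≤p
    ...     | inj₂ d≡p = subst (λ d → power y d ≈ a ∙ b) d≡p yᵈ≈ε
    -- With a period below p, all p elements would be among fewer than p powers.
    ...     | inj₁ d<p = contradiction (injective same-element) (Fin.<⇒≢ k<l)
      where
      log : Fin p → Fin d
      log k = proj₁ (reduced y y≉ε d yᵈ≈ε (to k))
      to-log : ∀ k → to k ≈ power y (toℕ (log k))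
      to-log k = proj₂ (reduced y y≉ε d yᵈ≈ε (to k))
      collision = Fin.pigeonhole d<p log
      k = proj₁ collision
      l = proj₁ (proj₂ collision)
      k<l = proj₁ (proj₂ (proj₂ collision))
      same-element : to k ≈ to l
      same-element = ≈-trans (to-log k)
        (subst (λ r → power y (toℕ r) ≈ to l) (sym (proj₂ (proj₂ (proj₂ collision)))) (≈-sym (to-log l)))

    private
      module ₚ = Congruence p
      _∘_ = Loop._∙_ (principalIsotope a b)

    power≈ε⇒∣ : ∀ y → ¬ y ≈ a ∙ b → ∀ {d} → power y d ≈ a ∙ b → p ℕ.∣ d
    power≈ε⇒∣ y y≉ε {d} yᵈ≈ε with p ℕ.∣? d
    ... | yes p∣d = p∣d
    ... | no p∤d  = contradiction (coprime-powers y (exponent y) yᵈ≈ε (prime⇒coprime′ p-prime p∤d)) y≉ε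

    power-≈ : ∀ y → ¬ y ≈ a ∙ b → ∀ {i j} → power y i ≈ power y j → + i ₚ.≈ + j
    power-≈ y y≉ε {i} {j} eq with ℕ.≤-total i j
    ... | inj₁ i≤j = CongruenceProperties.∣⇒pos-≈ p i≤j (power≈ε⇒∣ y y≉ε (power-∸ y i≤j eq))
    ... | inj₂ j≤i = ₚ.≈-sym (CongruenceProperties.∣⇒pos-≈ p j≤i (power≈ε⇒∣ y y≉ε (power-∸ y j≤i (≈-sym eq))))

    -- The discrete logarithm to base `y`. It serves contrapositively: where no logarithm exists,
    -- some pair of exponents fails to add.
    additive⇒logarithm : ∀ y → ¬ y ≈ a ∙ b →
      (∀ (i j : Fin p) → power y (toℕ i) ∘ power y (toℕ j) ≈ power y (toℕ i ℕ.+ toℕ j)) →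
      Logarithm p (principalIsotope a b)
    additive⇒logarithm y y≉ε additive = record
      { log           = λ z → + toℕ (log z)
      ; log-cong      = λ {x} {z} x≈z → power-≈ y y≉ε (≈-trans (≈-sym (≈power x)) (≈-trans x≈z (≈power z)))
      ; log-injective = λ {x} {z} eq → ≈-trans (≈power x)
          (subst (λ k → power y (toℕ k) ≈ z) (sym (CongruenceProperties.toℕ-injective p eq))
             (≈-sym (≈power z)))
      ; log-∙         = λ x z → power-≈ y y≉ε (≈-trans (≈-sym (≈power (x ∘ z)))
          (≈-trans (Loop.∙-cong (principalIsotope a b) (≈power x) (≈power z)) (additive (log x) (log z))))
      }
      where
      log : Carrier → Fin p
      log z = proj₁ (reduced y y≉ε p (exponent y) z)
      ≈power : ∀ z → z ≈ power y (toℕ (log z))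
      ≈power z = proj₂ (reduced y y≉ε p (exponent y) z)

    kill : ∀ y → ¬ y ≈ a ∙ b → ∃ λ (I : Instruction p) → apply I y ≈ a ∙ b
    kill y y≉ε with Fin.¬∀⟶∃¬ p _ (λ i → Fin.all? (λ j → _ ≈? _))
                      (λ additive → not-cyclic a b (additive⇒logarithm y y≉ε additive))
    ... | i , ¬∀j with Fin.¬∀⟶∃¬ p _ (λ j → _ ≈? _) ¬∀j
    ...   | j , ≉ with generated y y≉ε (power y (toℕ i) ∘ power y (toℕ j))
    ...     | k , ≈yᵏ = record { e = e ; i = toℕ i ; j = toℕ j ; p∤ = p∤ } ,
      ≈-trans (act-cong e ≈-refl ≈yᵐ) yᵉyᵐ≈ε
      where
      -- Reduced modulo p, so that the complementary exponent p - m is a natural number.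
      m = k ℕ.% p
      e = p ℕ.∸ m
      ≈yᵐ = ≈-trans ≈yᵏ (power-% y k p (exponent y))
      yᵉyᵐ≈ε : act y e (power y m) ≈ a ∙ b
      yᵉyᵐ≈ε = subst (_≈ a ∙ b) (act-+ y e m (a ∙ b))
        (subst (λ r → power y r ≈ a ∙ b) (sym (ℕ.m∸n+n≡m (ℕ.<⇒≤ (ℕ.m%n<n k p)))) (exponent y))
      p∤ : ¬ p ℕ.∣ e ℕ.+ (toℕ i ℕ.+ toℕ j)
      -- If p divided this sum, cancelling the left power `e` would give that `yⁱ⁺ʲ` equals `yᵐ`,
      -- hence the product of `yⁱ` and `yʲ`, against the choice of i and j.
      p∤ (ℕ.divides q eq) = ≉ (≈-trans ≈yᵐ (act-cancel y e (≈-trans yᵉyᵐ≈ε (≈-sym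
        (subst (_≈ a ∙ b) (act-+ y e _ (a ∙ b)) (subst (λ r → power y r ≈ a ∙ b) (sym eq)
          (power-* y q p (exponent y))))))))

  Triple : Set
  Triple = Fin p × Fin p × Fin p

  Killed : List (Instruction p) → Triple → Set
  Killed Is (a , b , y) = Run.run (principalIsotope (to a) (to b)) Is (to y) ≈ to a ∙ to b

  Kills : List (Instruction p) → List Triple → Set
  Kills Is ts = ∀ {t} → t ∈ ts → Killed Is t

  -- Instructions fix the identity, so a further one cannot revive what has been killed.
  kills-∷ : ∀ {I Is ts} → Kills Is ts → Kills (I ∷ Is) ts
  kills-∷ {I} kills {a , b , y} t∈ts = ≈-trans (apply-cong I (kills t∈ts)) (apply-ε I)
    where open Run (principalIsotope (to a) (to b))

  kills-here : ∀ {Is t ts} → Killed Is t → Kills Is ts → Kills Is (t ∷ ts)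
  kills-here killed kills (here refl)  = killed
  kills-here killed kills (there t∈ts) = kills t∈ts

  killed? : ∀ Is t → Dec (Killed Is t)
  killed? Is (a , b , y) = _ ≈? _

  kill-one : ∀ Is t → ¬ Killed Is t → ∃ λ I → Killed (I ∷ Is) t
  kill-one Is (a , b , y) = kill (to a) (to b) _

  -- A triple that survives the present instructions gets one more, chosen for the value they leave
  -- and not for its original `y`.
  kill-list : ∀ ts → ∃ λ Is → Kills Is ts
  kill-list []       = [] , λ ()
  kill-list (t ∷ ts) = extend (kill-list ts)
    where
    extend : (∃ λ Is → Kills Is ts) → ∃ λ Is → Kills Is (t ∷ ts)
    extend (Is , kills) with killed? Is t
    ... | yes killed   = Is , kills-here {Is} {t} killed kills
    ... | no ¬killed   = proj₁ next ∷ Is ,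
      kills-here {proj₁ next ∷ Is} {t} (proj₂ next) (λ {s} → kills-∷ {proj₁ next} {Is} kills {s})
      where next = kill-one Is t ¬killed

  all-killed : ∃ λ Is → ∀ t → Killed Is t
  all-killed with kill-list (cartesianProduct (allFin p) (cartesianProduct (allFin p) (allFin p)))
  ... | Is , kills = Is , λ { (a , b , y) →
      kills (∈-cartesianProduct⁺ (∈-allFin a) (∈-cartesianProduct⁺ (∈-allFin b) (∈-allFin y))) }

  instructions : List (Instruction p)
  instructions = proj₁ all-killed

  kill-identity : IsotopeIdentities (runᵗ instructions) e-term
  kill-identity a b ρ =
    ≈-trans (eval-cong (≈-sym (to-index a)) (≈-sym (to-index b)) (λ i → ≈-sym (to-index (ρ i))) (runᵗ instructions))
    (≈-trans (eval-run (principalIsotope _ _) _ instructions)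
    (≈-trans (proj₂ all-killed (index a , index b , index (ρ 0)))
    (≈-trans (∙-cong (to-index a) (to-index b))
    (≈-sym (LoopProperties.x\\x≈ε (principalIsotope a b) (ρ 0))))))

  power-identity : IsotopeIdentities (actᵗ (var 0) p e-term) e-term
  power-identity a b ρ = ≈-trans (eval-power (principalIsotope a b) ρ (var 0) p)
    (≈-trans (exponent a b (ρ 0)) (≈-sym (LoopProperties.x\\x≈ε (principalIsotope a b) (ρ 0))))

  module _ {c ℓ} {L : Loop c ℓ} (L∈V : LoopVariety c ℓ IsotopeIdentities L) where
    open Loop L using ()
      renaming (Carrier to Carrierᴸ; _≈_ to _≈ᴸ_; ε to εᴸ; trans to ≈ᴸ-trans; sym to ≈ᴸ-sym)
    open LeftPower L
    open Run L
    open LoopProperties L using (x\\x≈ε)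

    member-exponent : ∀ y → power y p ≈ᴸ εᴸ
    member-exponent y = ≈ᴸ-trans (≈ᴸ-sym (eval-power L (λ _ → y) (var 0) p))
      (≈ᴸ-trans (L∈V (actᵗ (var 0) p e-term) e-term power-identity (λ _ → y)) (x\\x≈ε y))

    group⇒trivial : IsGroup L → Trivial L
    group⇒trivial assoc y = run-group assoc p-prime member-exponent instructions y
      (≈ᴸ-trans (≈ᴸ-sym (eval-run L (λ _ → y) instructions))
      (≈ᴸ-trans (L∈V (runᵗ instructions) e-term kill-identity (λ _ → y)) (x\\x≈ε y)))

    power-index-injective : ∀ {y} → ¬ y ≈ᴸ εᴸ → ∀ {i j : Fin p} → power y (toℕ i) ≈ᴸ power y (toℕ j) → i ≡ j
    power-index-injective {y} y≉ε {i} {j} eq with ℕ.≤-total (toℕ i) (toℕ j)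
    ... | inj₁ i≤j = Fin.toℕ-injective (power-injective p-prime y y≉ε (member-exponent y) i≤j (Fin.toℕ<n j) eq)
    ... | inj₂ j≤i = sym (Fin.toℕ-injective
      (power-injective p-prime y y≉ε (member-exponent y) j≤i (Fin.toℕ<n i) (≈ᴸ-sym eq)))

  module _ (c ℓ : Level) where

    origin : Carrier
    origin = to (Fin.fromℕ< (ℕ.>-nonZero⁻¹ p))

    base : Loop 0ℓ 0ℓ
    base = principalIsotope origin origin

    smallest : Loop c ℓ
    smallest = liftLoop c ℓ base

    smallest∈V : LoopVariety c ℓ IsotopeIdentities smallest
    smallest∈V s t holds ρ = lift
      (subst₂ _≈_ (sym (eval-lift base ρ s)) (sym (eval-lift base ρ t)) (holds origin origin _))

    smallest-nonTrivial : NonTrivial smallest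
    smallest-nonTrivial
      with to (Fin.fromℕ< {0} 0<p) ≈? (origin ∙ origin) | to (Fin.fromℕ< {1} 1<p) ≈? (origin ∙ origin)
      where
      1<p = ℕ.nonTrivial⇒n>1 p {{prime⇒nonTrivial p-prime}}
      0<p = ℕ.<-trans (s≤s z≤n) 1<p
    ... | no ≉ε | _      = lift _ , λ eq → ≉ε (lower eq)
    ... | _     | no ≉ε  = lift _ , λ eq → ≉ε (lower eq)
    ... | yes ≈ε | yes ≈ε′ = contradiction
      (trans (sym (Fin.toℕ-fromℕ< _))
        (trans (cong toℕ (injective (≈-trans ≈ε (≈-sym ≈ε′)))) (Fin.toℕ-fromℕ< _))) λ ()

    smallest-order : HasOrder smallest p
    smallest-order = record
      { to        = λ i → lift (to i)
      ; cong      = λ eq → lift (Bijection.cong order eq)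
      ; bijective = (λ eq → injective (lower eq))
                  , λ x → index (lower x) , λ eq → lift (≈-trans (Bijection.cong order eq) (to-index (lower x)))
      }

    smallest-embeds : ∀ L → LoopVariety c ℓ IsotopeIdentities L → NonTrivial L →
                      Injection (Loop.setoid smallest) (Loop.setoid L)
    smallest-embeds L L∈V (y , y≉ε) = record
      { to        = λ x → power y (toℕ (index (lower x)))
      ; cong      = λ eq → Loop.reflexive L (cong (λ i → power y (toℕ i)) (index-cong (lower eq)))
      ; injective = λ eq → lift (index-injective (power-index-injective {L = L} L∈V y≉ε eq))
      }
      where open LeftPower L

    falconerVariety : FalconerVariety c ℓ
    falconerVariety = record
      { identities          = IsotopeIdentities
      ; nonTrivial          = smallest , smallest∈V , smallest-nonTrivial
      ; antiAssociative     = λ L L∈V → group⇒trivial {L = L} L∈V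
      ; isotopicallyLClosed = λ L L′ L∈V I s t holds →
          satisfies-isotopic I s t (L∈V (isotope s) (isotope t) (isotope-closed s t holds))
      }

    smallest-isSmallest : IsSmallestNonTrivialMember (FalconerVariety.variety falconerVariety) smallest
    smallest-isSmallest = smallest∈V , smallest-nonTrivial , smallest-embeds

-- The Latin square on ℤ/p.

module LatinSquare (m : ℕ) (M : DoublingClosed (suc (m ℕ.+ m))) where

  p : ℕ
  p = suc (m ℕ.+ m)

  open Congruence p
  open OddCongruence m
  open DoublingClosed M
  open CongruenceProperties p
  open SetoidReasoning ≈-setoid

  ψ : ℤ → ℤ
  ψ x with N? x
  ... | yes _ = - + 2 * x
  ... | no _  = x

  ψ-in : ∀ {x} → N x → ψ x ≡ - + 2 * x
  ψ-in {x} x∈N with N? x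
  ... | yes _  = refl
  ... | no x∉N = contradiction x∈N x∉N

  ψ-out : ∀ {x} → ¬ N x → ψ x ≡ x
  ψ-out {x} x∉N with N? x
  ... | yes x∈N = contradiction x∈N x∉N
  ... | no _    = refl

  ψ⁻¹ : ℤ → ℤ
  ψ⁻¹ x with N? x
  ... | yes _ = -½ x
  ... | no _  = x

  ψ⁻¹-in : ∀ {x} → N x → ψ⁻¹ x ≡ -½ x
  ψ⁻¹-in {x} x∈N with N? x
  ... | yes _  = refl
  ... | no x∉N = contradiction x∈N x∉N

  ψ⁻¹-out : ∀ {x} → ¬ N x → ψ⁻¹ x ≡ x
  ψ⁻¹-out {x} x∉N with N? x
  ... | yes x∈N = contradiction x∈N x∉N
  ... | no _    = refl

  -½*-2 : ∀ x → -½ (- + 2 * x) ≈ x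
  -½*-2 x = ≈-trans (≡⇒≈ (eq (- + suc m) x)) (-2*-½ x)
    where
    eq : ∀ c x → c * (- + 2 * x) ≡ - + 2 * (c * x)
    eq = solve-∀

  -½-in : ∀ {x} → N x → N (-½ x)
  -½-in {x} x∈N = halve (N-resp (≈-sym (-2*-½ x)) x∈N)

  by-cases : ∀ (x : ℤ) {P : Set} → (N x → P) → (¬ N x → P) → P
  by-cases x f g with N? x
  ... | yes x∈N = f x∈N
  ... | no x∉N  = g x∉N

  ψ-cong : ∀ {x y} → x ≈ y → ψ x ≈ ψ y
  ψ-cong {x} {y} x≈y = by-cases x
    (λ x∈N → begin
      ψ x          ≡⟨ ψ-in x∈N ⟩
      - + 2 * x    ≈⟨ scale (- + 2) x≈y ⟩
      - + 2 * y    ≡⟨ ψ-in (N-resp x≈y x∈N) ⟨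
      ψ y          ∎)
    (λ x∉N → begin
      ψ x          ≡⟨ ψ-out x∉N ⟩
      x            ≈⟨ x≈y ⟩
      y            ≡⟨ ψ-out (λ y∈N → x∉N (N-resp (≈-sym x≈y) y∈N)) ⟨
      ψ y          ∎)

  ψ⁻¹-cong : ∀ {x y} → x ≈ y → ψ⁻¹ x ≈ ψ⁻¹ y
  ψ⁻¹-cong {x} {y} x≈y = by-cases x
    (λ x∈N → begin
      ψ⁻¹ x        ≡⟨ ψ⁻¹-in x∈N ⟩
      -½ x         ≈⟨ scale (- + suc m) x≈y ⟩
      -½ y         ≡⟨ ψ⁻¹-in (N-resp x≈y x∈N) ⟨
      ψ⁻¹ y        ∎)
    (λ x∉N → begin
      ψ⁻¹ x        ≡⟨ ψ⁻¹-out x∉N ⟩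
      x            ≈⟨ x≈y ⟩
      y            ≡⟨ ψ⁻¹-out (λ y∈N → x∉N (N-resp (≈-sym x≈y) y∈N)) ⟨
      ψ⁻¹ y        ∎)

  ψ-ψ⁻¹ : ∀ x → ψ (ψ⁻¹ x) ≈ x
  ψ-ψ⁻¹ x = by-cases x
    (λ x∈N → begin
      ψ (ψ⁻¹ x)       ≡⟨ cong ψ (ψ⁻¹-in x∈N) ⟩
      ψ (-½ x)        ≡⟨ ψ-in (-½-in x∈N) ⟩
      - + 2 * -½ x    ≈⟨ -2*-½ x ⟩
      x               ∎)
    (λ x∉N → ≡⇒≈ (trans (cong ψ (ψ⁻¹-out x∉N)) (ψ-out x∉N)))

  ψ⁻¹-ψ : ∀ x → ψ⁻¹ (ψ x) ≈ x
  ψ⁻¹-ψ x = by-cases x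
    (λ x∈N → begin
      ψ⁻¹ (ψ x)          ≡⟨ cong ψ⁻¹ (ψ-in x∈N) ⟩
      ψ⁻¹ (- + 2 * x)    ≡⟨ ψ⁻¹-in (double x∈N) ⟩
      -½ (- + 2 * x)     ≈⟨ -½*-2 x ⟩
      x                  ∎)
    (λ x∉N → ≡⇒≈ (trans (cong ψ⁻¹ (ψ-out x∉N)) (ψ⁻¹-out x∉N)))

  -- The inverse of x ↦ x + ψ x, which is - x on N and 2 x = - (- 2 x) off N.
  θ : ℤ → ℤ
  θ w with N? (- w)
  ... | yes _ = - w
  ... | no _  = -½ (- w)

  θ-in : ∀ {w} → N (- w) → θ w ≡ - w
  θ-in {w} ∈N with N? (- w)
  ... | yes _ = refl
  ... | no ∉N = contradiction ∈N ∉N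

  θ-out : ∀ {w} → ¬ N (- w) → θ w ≡ -½ (- w)
  θ-out {w} ∉N with N? (- w)
  ... | yes ∈N = contradiction ∈N ∉N
  ... | no _   = refl

  θ-cong : ∀ {x y} → x ≈ y → θ x ≈ θ y
  θ-cong {x} {y} x≈y = by-cases (- x)
    (λ ∈N → begin
      θ x          ≡⟨ θ-in ∈N ⟩
      - x          ≈⟨ neg-cong x≈y ⟩
      - y          ≡⟨ θ-in (N-resp (neg-cong x≈y) ∈N) ⟨
      θ y          ∎)
    (λ ∉N → begin
      θ x          ≡⟨ θ-out ∉N ⟩
      -½ (- x)     ≈⟨ scale (- + suc m) (neg-cong x≈y) ⟩
      -½ (- y)     ≡⟨ θ-out (λ ∈N → ∉N (N-resp (neg-cong (≈-sym x≈y)) ∈N)) ⟨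
      θ y          ∎)

  θ-inverseˡ : ∀ x → θ (x + ψ x) ≈ x
  θ-inverseˡ x = by-cases x
    (λ x∈N → let -[x+ψx]≡x = trans (cong (λ z → - (x + z)) (ψ-in x∈N)) (in-eq x) in begin
      θ (x + ψ x)          ≡⟨ θ-in (subst N (sym -[x+ψx]≡x) x∈N) ⟩
      - (x + ψ x)          ≡⟨ -[x+ψx]≡x ⟩
      x                    ∎)
    (λ x∉N → let -[x+ψx]≡-2x = trans (cong (λ z → - (x + z)) (ψ-out x∉N)) (out-eq x) in begin
      θ (x + ψ x)          ≡⟨ θ-out (λ ∈N → x∉N (halve (subst N -[x+ψx]≡-2x ∈N))) ⟩
      -½ (- (x + ψ x))     ≡⟨ cong -½ -[x+ψx]≡-2x ⟩
      -½ (- + 2 * x)       ≈⟨ -½*-2 x ⟩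
      x                    ∎)
    where
    in-eq : ∀ x → - (x + - + 2 * x) ≡ x
    in-eq = solve-∀
    out-eq : ∀ x → - (x + x) ≡ - + 2 * x
    out-eq = solve-∀

  θ-inverseʳ : ∀ w → θ w + ψ (θ w) ≈ w
  θ-inverseʳ w = by-cases (- w)
    (λ ∈N → ≡⇒≈ (trans (cong (λ z → z + ψ z) (θ-in ∈N)) (trans (cong (λ z → - w + z) (ψ-in ∈N)) (in-eq w))))
    (λ ∉N → begin
      θ w + ψ (θ w)              ≡⟨ cong (λ z → z + ψ z) (θ-out ∉N) ⟩
      -½ (- w) + ψ (-½ (- w))
        ≡⟨ cong (λ z → -½ (- w) + z) (ψ-out (λ ∈N → ∉N (N-resp (-2*-½ (- w)) (double ∈N)))) ⟩
      -½ (- w) + -½ (- w)        ≡⟨ out-eq (-½ (- w)) ⟩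
      - (- + 2 * -½ (- w))       ≈⟨ neg-cong (-2*-½ (- w)) ⟩
      - - w                      ≡⟨ ℤ.neg-involutive w ⟩
      w                          ∎)
    where
    in-eq : ∀ w → - w + - + 2 * - w ≡ w
    in-eq = solve-∀
    out-eq : ∀ z → z + z ≡ - (- + 2 * z)
    out-eq = solve-∀

  sub-cong : ∀ {a b c d} → a ≈ b → c ≈ d → a - c ≈ b - d
  sub-cong a≈b c≈d = +-cong a≈b (neg-cong c≈d)

  sub-congˡ : ∀ a {c d} → c ≈ d → a - c ≈ a - d
  sub-congˡ a = sub-cong (≈-refl {a})

  +-congˡ : ∀ a {c d} → c ≈ d → a + c ≈ a + d
  +-congˡ a = +-cong (≈-refl {a})

  cancel-sub : ∀ x y → x - (x - y) ≡ y
  cancel-sub = solve-∀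

  quasigroup : Quasigroup 0ℓ 0ℓ
  quasigroup = record
    { Carrier = ℤ
    ; _≈_     = _≈_
    ; _∙_     = λ i j → i - ψ (j - i)
    ; _\\_    = λ i s → i + ψ⁻¹ (i - s)
    ; _//_    = λ s j → j - θ (j - s)
    ; isQuasigroup = record
      { isMagma = record
        { isEquivalence = Setoid.isEquivalence ≈-setoid
        ; ∙-cong        = λ p q → sub-cong p (ψ-cong (sub-cong q p))
        }
      ; \\-cong      = λ p q → +-cong p (ψ⁻¹-cong (sub-cong p q))
      ; //-cong      = λ p q → sub-cong q (θ-cong (sub-cong q p))
      ; leftDivides  = (λ i s → begin
          i - ψ (i + ψ⁻¹ (i - s) - i)    ≡⟨ cong (λ z → i - ψ z) (eq₁ i (ψ⁻¹ (i - s))) ⟩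
          i - ψ (ψ⁻¹ (i - s))            ≈⟨ sub-congˡ i (ψ-ψ⁻¹ (i - s)) ⟩
          i - (i - s)                    ≡⟨ cancel-sub i s ⟩
          s                              ∎)
        , (λ i j → begin
          i + ψ⁻¹ (i - (i - ψ (j - i)))  ≡⟨ cong (λ z → i + ψ⁻¹ z) (cancel-sub i (ψ (j - i))) ⟩
          i + ψ⁻¹ (ψ (j - i))            ≈⟨ +-congˡ i (ψ⁻¹-ψ (j - i)) ⟩
          i + (j - i)                    ≡⟨ eq₂ i j ⟩
          j                              ∎)
      ; rightDivides = (λ j s → begin
          j - θ (j - s) - ψ (j - (j - θ (j - s)))   ≡⟨ cong (λ z → j - θ (j - s) - ψ z) (cancel-sub j (θ (j - s))) ⟩
          j - θ (j - s) - ψ (θ (j - s))             ≡⟨ eq₃ j (θ (j - s)) (ψ (θ (j - s))) ⟩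
          j - (θ (j - s) + ψ (θ (j - s)))           ≈⟨ sub-congˡ j (θ-inverseʳ (j - s)) ⟩
          j - (j - s)                               ≡⟨ cancel-sub j s ⟩
          s                                         ∎)
        , (λ j i → begin
          j - θ (j - (i - ψ (j - i)))               ≡⟨ cong (λ z → j - θ z) (eq₄ j i (ψ (j - i))) ⟩
          j - θ (j - i + ψ (j - i))                 ≈⟨ sub-congˡ j (θ-inverseˡ (j - i)) ⟩
          j - (j - i)                               ≡⟨ cancel-sub j i ⟩
          i                                         ∎)
      }
    }
    where
    eq₁ : ∀ i x → i + x - i ≡ x
    eq₁ = solve-∀
    eq₂ : ∀ i j → i + (j - i) ≡ j
    eq₂ = solve-∀
    eq₃ : ∀ j x y → j - x - y ≡ j - (x + y)
    eq₃ = solve-∀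
    eq₄ : ∀ j i x → j - (i - x) ≡ j - i + x
    eq₄ = solve-∀

  order : Bijection (≡.setoid (Fin p)) ≈-setoid
  order = record
    { to        = λ i → + toℕ i
    ; cong      = λ eq → ≡⇒≈ (cong (λ i → + toℕ i) eq)
    ; bijective = toℕ-injective , λ x → proj₁ (residue x) , λ { refl → proj₂ (residue x) }
    }

  -- Left multiplications of the isotopes act in a single orbit.

  module _ (p-prime : Prime p) (N-nonempty : ∃ N) where
    open PrimeField p-prime
    open Quasigroup quasigroup using (_∙_; _\\_; _//_; ∙-cong; \\-cong; rightDividesˡ)
    open PrincipalIsotope quasigroup

    -- Left multiplication by y in the isotope maps row a to row r; after scaling by their
    -- difference δ its orbits are those of the walk between the two sheets.
    module Orbit (a b y : ℤ) (y≉ε : ¬ y ≈ a ∙ b) where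
      open Powers a b

      r δ : ℤ
      r = y // b
      δ = r - a

      δ≉0 : ¬ δ ≈ 0ℤ
      δ≉0 δ≈0 = y≉ε (≈-trans (≈-sym (rightDividesˡ b y))
        (∙-cong {r} {a} {b} {b} (combine₁ 1ℤ δ≈0 (eq r a)) ≈-refl))
        where
        eq : ∀ r a → r - a ≡ 1ℤ * (r - a - 0ℤ)
        eq = solve-∀

      -- Orbit equivalence by forward powers alone; it is transitive because powers of one map
      -- commute.
      _~_ : ℤ → ℤ → Set
      x ~ z = ∃₂ λ i j → act y i x ≈ act y j z

      orbits : Setoid 0ℓ 0ℓ
      orbits = record
        { Carrier       = ℤ
        ; _≈_           = _~_
        ; isEquivalence = record
          { refl  = 0 , 0 , ≈-refl
          ; sym   = λ { (i , j , eq) → j , i , ≈-sym eq }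
          ; trans = λ { {x} {w} {z} (i , j , eq) (k , l , eq′) → k ℕ.+ i , j ℕ.+ l , (begin
              act y (k ℕ.+ i) x      ≡⟨ act-+ y k i x ⟩
              act y k (act y i x)    ≈⟨ act-cong k ≈-refl eq ⟩
              act y k (act y j w)    ≡⟨ act-+ y k j w ⟨
              act y (k ℕ.+ j) w      ≡⟨ cong (λ n → act y n w) (ℕ.+-comm k j) ⟩
              act y (j ℕ.+ k) w      ≡⟨ act-+ y j k w ⟩
              act y j (act y k w)    ≈⟨ act-cong j ≈-refl eq′ ⟩
              act y j (act y l z)    ≡⟨ act-+ y j l z ⟨
              act y (j ℕ.+ l) z      ∎) }
          }
        }

      ≈⇒~ : ∀ {x z} → x ≈ z → x ~ z
      ≈⇒~ eq = 0 , 0 , eq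

      -- `H x` is the entry of row `a` in column `a + δ x`, while `K` lists the symbols in equal
      -- steps. Passing from `H` to `K` only rewrites an entry by the definition of `ψ`; passing
      -- from `K` to `H` undoes one left multiplication by `y`.
      H K : ℤ → ℤ
      H x = a - ψ (δ * x)
      K x = a - δ * (x - 1ℤ)

      a\\H : ∀ x → a \\ H x ≈ a + δ * x
      a\\H x = +-congˡ a (≈-trans (≡⇒≈ (cong ψ⁻¹ (cancel-sub a (ψ (δ * x))))) (ψ⁻¹-ψ (δ * x)))

      -- Since r = a + δ, the column with offset δ (x + 1) from row `a` has offset δ x from row `r`;
      -- this is the shift by one in the walk.
      next : ∀ x → H (x + 1ℤ) ~ (r - ψ (δ * x))
      next x = 1 , 0 , (begin
        r ∙ (a \\ H (x + 1ℤ))         ≈⟨ ∙-cong {r} {r} ≈-refl (a\\H (x + 1ℤ)) ⟩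
        r ∙ (a + δ * (x + 1ℤ))        ≡⟨ cong (λ z → r - ψ z) (eq r a x) ⟩
        r - ψ (δ * x)                 ∎)
        where
        eq : ∀ r a x → a + (r - a) * (x + 1ℤ) - r ≡ (r - a) * x
        eq = solve-∀

      move-2 : ∀ x → δ * (- + 2 * x) ≡ - + 2 * (δ * x)
      move-2 = eq δ
        where
        eq : ∀ δ x → δ * (- + 2 * x) ≡ - + 2 * (δ * x)
        eq = solve-∀

      scaled : DoublingClosed p
      scaled = record
        { N      = λ x → N (δ * x)
        ; N?     = λ x → N? (δ * x)
        ; N-resp = λ x≈y → N-resp (scale δ x≈y)
        ; double = λ {x} ∈N → subst N (sym (move-2 x)) (double ∈N)
        ; halve  = λ {x} ∈N → halve (subst N (move-2 x) ∈N)
        }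

      sheets : TwoSheets p scaled orbits
      sheets = record
        { H       = H
        ; K       = K
        ; H-cong  = λ x≈y → ≈⇒~ (sub-congˡ a (ψ-cong (scale δ x≈y)))
        ; K-cong  = λ x≈y → ≈⇒~ (sub-congˡ a (scale δ (sub-cong x≈y (≈-refl {1ℤ}))))
        ; HK-fix  = λ {x} ∉N → ≈⇒~ (≡⇒≈ (trans (cong (λ z → a - z) (ψ-out ∉N)) (eq₁ a δ x)))
        ; KH-fix  = λ {x} ∉N → Setoid.sym orbits (Setoid.trans orbits (next x)
            (≈⇒~ (≡⇒≈ (trans (cong (λ z → r - z) (ψ-out ∉N)) (eq₂ r a x)))))
        ; HK-move = λ {x} ∈N → ≈⇒~ (≡⇒≈ (trans (cong (λ z → a - z) (ψ-in ∈N)) (eq₃ a δ x)))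
        ; KH-move = λ {x} ∈N → Setoid.sym orbits (Setoid.trans orbits (next x)
            (≈⇒~ (≡⇒≈ (trans (cong (λ z → r - z) (ψ-in ∈N)) (eq₄ r a x)))))
        }
        where
        eq₁ : ∀ a δ x → a - δ * x ≡ a - δ * (x + 1ℤ - 1ℤ)
        eq₁ = solve-∀
        eq₂ : ∀ r a x → r - (r - a) * x ≡ a - (r - a) * (x - 1ℤ)
        eq₂ = solve-∀
        eq₃ : ∀ a δ x → a - - + 2 * (δ * x) ≡ a - δ * (- + 2 * x + 1ℤ - 1ℤ)
        eq₃ = solve-∀
        eq₄ : ∀ r a x → r - - + 2 * ((r - a) * x) ≡ a - (r - a) * (- + 2 * x - 1ℤ)
        eq₄ = solve-∀

      open SingleOrbit m scaled orbits sheets using (H-constant)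

      scaled-nonempty : ∃ λ x → N (δ * x)
      scaled-nonempty = proj₁ x , N-resp (≈-sym (proj₂ x)) (proj₂ N-nonempty)
        where x = solution δ (proj₁ N-nonempty) δ≉0

      H-surjective : ∀ z → ∃ λ x → z ≈ H x
      H-surjective z = proj₁ x , (begin
        z                              ≡⟨ cancel-sub a z ⟨
        a - (a - z)                    ≈⟨ sub-congˡ a (ψ-ψ⁻¹ (a - z)) ⟨
        a - ψ (ψ⁻¹ (a - z))            ≈⟨ sub-congˡ a (ψ-cong (proj₂ x)) ⟨
        a - ψ (δ * proj₁ x)            ∎)
        where x = solution δ (ψ⁻¹ (a - z)) δ≉0

      same-orbit : ∀ z z′ → z ~ z′
      same-orbit z z′ = Setoid.trans orbits (≈⇒~ (proj₂ x)) (Setoid.trans orbits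
        (H-constant scaled-nonempty (proj₁ x) (proj₁ x′)) (Setoid.sym orbits (≈⇒~ (proj₂ x′))))
        where
        x  = H-surjective z
        x′ = H-surjective z′

    connected : Connected
    connected a b y y≉ε z = Orbit.same-orbit a b y y≉ε z (a ∙ b)

  -- No isotope of the square is a cyclic group.

  module _ (p-prime : Prime p) (3<p : 3 < p) (N-nonempty : ∃ N)
    (0∉N : ¬ N 0ℤ) (1∉N : ¬ N 1ℤ) (-2∉N : ¬ N (- + 2)) where

    open PrimeField p-prime
    open Quasigroup quasigroup using (_∙_; _\\_; _//_; ∙-cong; \\-cong; leftDividesʳ; rightDividesʳ)
    open PrincipalIsotope quasigroup

    -- Offsets 1 and - 2 make the differences B (j + 2) - B j have period 3, hence constant, equal
    -- to μ; so B and C are linear and an offset in N gives 3 μ ≈ 0.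
    module _ (A B C : ℤ → ℤ)
      (B-cong : ∀ {x y} → x ≈ y → B x ≈ B y) (C-cong : ∀ {x y} → x ≈ y → C x ≈ C y)
      (C-∙ : ∀ i j → C (i ∙ j) ≈ A i + B j) where

      entry : ∀ {i j k d} → j - i ≡ d → i - ψ d ≈ k → C k ≈ A i + B j
      entry {i} {j} refl eq = ≈-trans (C-cong (≈-sym eq)) (C-∙ i j)

      row : ∀ {i j j′ k k′} → C k ≈ A i + B j → C k′ ≈ A i + B j′ → C k - C k′ ≈ B j - B j′
      row {i} {j} {j′} {k} {k′} p q = combine₂ 1ℤ (- 1ℤ) p q (eq (A i) (B j) (B j′) (C k) (C k′))
        where
        eq : ∀ a b b′ c c′ → c - c′ - (b - b′) ≡ 1ℤ * (c - (a + b)) + - 1ℤ * (c′ - (a + b′))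
        eq = solve-∀

      diagonal : ∀ i → C i ≈ A i + B i
      diagonal i = entry (ℤ.+-inverseʳ i) (≡⇒≈ (trans (cong (λ z → i - z) (ψ-out 0∉N)) (ℤ.+-identityʳ i)))

      out-entry : ∀ {d} → ¬ N d → ∀ i → C (i - d) - C i ≈ B (i + d) - B i
      out-entry {d} d∉N i = row (entry (eq i d) (≡⇒≈ (cong (λ z → i - z) (ψ-out d∉N)))) (diagonal i)
        where
        eq : ∀ i d → i + d - i ≡ d
        eq = solve-∀

      in-entry : ∀ {d} → N d → ∀ i → C (i - - + 2 * d) - C i ≈ B (i + d) - B i
      in-entry {d} d∈N i = row (entry (eq i d) (≡⇒≈ (cong (λ z → i - z) (ψ-in d∈N)))) (diagonal i)
        where
        eq : ∀ i d → i + d - i ≡ d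
        eq = solve-∀

      F : ℤ → ℤ
      F j = B (j + + 2) - B j

      -- Offset 1, used at i + 2 and at i + 1: the terms C (i + 1) and B (i + 2) cancel.
      C-step : ∀ i → C (i + + 2) - C i ≈ - F (i + 1ℤ)
      C-step i = combine₂ 1ℤ 1ℤ (step (i + + 2)) (step (i + 1ℤ)) (trans
        (eq (C (i + + 2)) (C i) (B (i + 1ℤ)) (B (i + 1ℤ + + 2)) (C (i + 1ℤ)) (B (i + + 2)))
        (cong₂ _+_ (cong₂ (λ x y → 1ℤ * (C (i + + 2) - C x - (B (i + + 2) - B y))) (e₁ i) (e₂ i))
                   (cong₂ (λ x y → 1ℤ * (C (i + 1ℤ) - C x - (B (i + 1ℤ) - B y))) (e₃ i) (e₄ i))))
        where
        step : ∀ i → C i - C (i - 1ℤ) ≈ B i - B (i + 1ℤ)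
        step i = combine₁ (- 1ℤ) (out-entry 1∉N i) (eq′ (C i) (C (i - 1ℤ)) (B i) (B (i + 1ℤ)))
          where
          eq′ : ∀ c c′ b b′ → c - c′ - (b - b′) ≡ - 1ℤ * (c′ - c - (b′ - b))
          eq′ = solve-∀
        eq : ∀ c₂ c₀ b₁ b₃ c₁ b₂ → c₂ - c₀ - - (b₃ - b₁) ≡ 1ℤ * (c₂ - c₁ - (b₂ - b₃)) + 1ℤ * (c₁ - c₀ - (b₁ - b₂))
        eq = solve-∀
        e₁ : ∀ i → i + 1ℤ ≡ i + + 2 - 1ℤ
        e₁ = solve-∀
        e₂ : ∀ i → i + 1ℤ + + 2 ≡ i + + 2 + 1ℤ
        e₂ = solve-∀
        e₃ : ∀ i → i ≡ i + 1ℤ - 1ℤ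
        e₃ = solve-∀
        e₄ : ∀ i → i + + 2 ≡ i + 1ℤ + 1ℤ
        e₄ = solve-∀

      -- Offset - 2 at j + 2 expresses by `F j` the same difference of `C` that `C-step` expresses
      -- by `F (j + 3)`.
      F-periodic : ∀ j → F (j + + 3) ≈ F j
      F-periodic j = combine₂ 1ℤ (- 1ℤ) (C-step (j + + 2)) (out-entry -2∉N (j + + 2)) (trans
        (eq (F (j + + 3)) (B (j + + 2)) (B j) (C (j + + 2 + + 2)) (C (j + + 2)))
        (cong₂ (λ x y → 1ℤ * (C (j + + 2 + + 2) - C (j + + 2) - - F x)
                        + - 1ℤ * (C (j + + 2 - - + 2) - C (j + + 2) - (B y - B (j + + 2)))) (e₁ j) (e₂ j)))
        where
        eq : ∀ f b₂ b₀ c₄ c₂ → f - (b₂ - b₀) ≡ 1ℤ * (c₄ - c₂ - - f) + - 1ℤ * (c₄ - c₂ - (b₀ - b₂))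
        eq = solve-∀
        e₁ : ∀ j → j + + 3 ≡ j + + 2 + 1ℤ
        e₁ = solve-∀
        e₂ : ∀ j → j ≡ j + + 2 + - + 2
        e₂ = solve-∀

      F-cong : ∀ {i j} → i ≈ j → F i ≈ F j
      F-cong i≈j = sub-cong (B-cong (+-cong i≈j (≈-refl {+ 2}))) (B-cong i≈j)

      μ : ℤ
      μ = F 0ℤ

      3≉0 : ¬ + 3 ≈ 0ℤ
      3≉0 = pos≉0 (s≤s z≤n) 3<p

      -- Every residue is a multiple of 3, because 3 is invertible modulo p.
      F≈μ : ∀ j → F j ≈ μ
      F≈μ j = ≈-trans
        (F-cong (≈-sym (≈-trans (scale (+ 3) (proj₂ (residue k))) (proj₂ (solution (+ 3) j 3≉0)))))
        (multiple (toℕ (proj₁ (residue k))))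
        where
        k = proj₁ (solution (+ 3) j 3≉0)
        multiple : ∀ k → F (+ 3 * + k) ≈ μ
        multiple zero    = ≈-refl
        multiple (suc k) = ≈-trans (≡⇒≈ (cong F (eq (+ k)))) (≈-trans (F-periodic (+ 3 * + k)) (multiple k))
          where
          eq : ∀ k → + 3 * (1ℤ + k) ≡ + 3 * k + + 3
          eq = solve-∀

      B-linear : ∀ k → B (+ 2 * + k) ≈ B 0ℤ + + k * μ
      B-linear zero    = ≡⇒≈ (sym (trans (cong (λ z → B 0ℤ + z) (ℤ.*-zeroˡ μ)) (ℤ.+-identityʳ _)))
      B-linear (suc k) = ≈-trans (≡⇒≈ (cong B (e₁ (+ k)))) (combine₂ 1ℤ 1ℤ (B-linear k) (F≈μ (+ 2 * + k))
        (eq (B (+ 2 * + k + + 2)) (B (+ 2 * + k)) (B 0ℤ) (+ k) μ))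
        where
        e₁ : ∀ k → + 2 * (1ℤ + k) ≡ + 2 * k + + 2
        e₁ = solve-∀
        eq : ∀ b₂ b b₀ k μ → b₂ - (b₀ + (1ℤ + k) * μ) ≡ 1ℤ * (b - (b₀ + k * μ)) + 1ℤ * (b₂ - b - μ)
        eq = solve-∀

      C-linear : ∀ k → C (+ 2 * + k) ≈ C 0ℤ - + k * μ
      C-linear zero    = ≡⇒≈ (sym (trans (cong (λ z → C 0ℤ - z) (ℤ.*-zeroˡ μ)) (ℤ.+-identityʳ _)))
      C-linear (suc k) = ≈-trans (≡⇒≈ (cong C (e₁ (+ k)))) (combine₂ 1ℤ 1ℤ (C-linear k)
        (≈-trans (C-step (+ 2 * + k)) (neg-cong (F≈μ (+ 2 * + k + 1ℤ))))
        (eq (C (+ 2 * + k + + 2)) (C (+ 2 * + k)) (C 0ℤ) (+ k) μ))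
        where
        e₁ : ∀ k → + 2 * (1ℤ + k) ≡ + 2 * k + + 2
        e₁ = solve-∀
        eq : ∀ c₂ c c₀ k μ → c₂ - (c₀ - (1ℤ + k) * μ) ≡ 1ℤ * (c - (c₀ - k * μ)) + 1ℤ * (c₂ - c - - μ)
        eq = solve-∀

      d : ℤ
      d = proj₁ N-nonempty

      d∈N : N d
      d∈N = proj₂ N-nonempty

      -- Half of `d` modulo p, since `B-linear` and `C-linear` speak of even arguments.
      t : ℕ
      t = toℕ (proj₁ (residue (- -½ d)))

      2t≈d : + 2 * + t ≈ d
      2t≈d = combine₂ (+ 2) 1ℤ (proj₂ (residue (- -½ d))) (-2*-½ d) (eq (+ t) (-½ d) d)
        where
        eq : ∀ t h d → + 2 * t - d ≡ + 2 * (t - - h) + 1ℤ * (- + 2 * h - d)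
        eq = solve-∀

      -- By linearity `B` gains t μ over the distance d and `C` loses 2 t μ over 2 d; the entry at
      -- offset `d` in `N` equates the two changes.
      3tμ≈0 : + 3 * (+ t * μ) ≈ 0ℤ
      3tμ≈0 = begin
        + 3 * (+ t * μ)                            ≡⟨ e₁ (+ t) μ (B 0ℤ) (C 0ℤ) ⟩
        (B 0ℤ + + t * μ - B 0ℤ) - (C 0ℤ - (+ t + + t) * μ - C 0ℤ)
          ≈⟨ sub-cong (sub-cong (B-linear t) (≈-refl {B 0ℤ})) (sub-cong (C-linear (t ℕ.+ t)) (≈-refl {C 0ℤ})) ⟨
        (B (+ 2 * + t) - B 0ℤ) - (C (+ 2 * (+ t + + t)) - C 0ℤ)
          ≈⟨ sub-cong (sub-cong (B-cong (≈-trans 2t≈d (≡⇒≈ (sym (ℤ.+-identityˡ d))))) (≈-refl {B 0ℤ}))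
               (sub-cong (C-cong (combine₁ (+ 2) 2t≈d (e₂ (+ t) d))) (≈-refl {C 0ℤ})) ⟩
        (B (0ℤ + d) - B 0ℤ) - (C (0ℤ - - + 2 * d) - C 0ℤ)
          ≈⟨ sub-congˡ (B (0ℤ + d) - B 0ℤ) (in-entry d∈N 0ℤ) ⟩
        (B (0ℤ + d) - B 0ℤ) - (B (0ℤ + d) - B 0ℤ)  ≡⟨ ℤ.+-inverseʳ (B (0ℤ + d) - B 0ℤ) ⟩
        0ℤ                                         ∎
        where
        e₁ : ∀ t μ b c → + 3 * (t * μ) ≡ (b + t * μ - b) - (c - (t + t) * μ - c)
        e₁ = solve-∀
        e₂ : ∀ t d → + 2 * (t + t) - (0ℤ - - + 2 * d) ≡ + 2 * (+ 2 * t - d)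
        e₂ = solve-∀

      t≉0 : ¬ + t ≈ 0ℤ
      t≉0 t≈0 = 0∉N (N-resp (≈-trans (≈-sym 2t≈d) (≈-trans (scale (+ 2) t≈0) ≈-refl)) d∈N)

      μ≈0 : μ ≈ 0ℤ
      μ≈0 = [ (λ 3≈0 → contradiction 3≈0 3≉0)
            , (λ tμ≈0 → [ (λ t≈0 → contradiction t≈0 t≉0) , (λ eq → eq) ]′ (integral (+ t) μ tμ≈0))
            ]′ (integral (+ 3) (+ t * μ) 3tμ≈0)

      not-injective : ¬ (∀ {x y} → B x ≈ B y → x ≈ y)
      not-injective B-injective = pos≉0 (s≤s z≤n) (ℕ.<-trans (ℕ.n<1+n 2) 3<p)
        (B-injective {+ 2} {0ℤ} (combine₁ 1ℤ μ≈0 (eq (B (+ 2)) (B 0ℤ))))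
        where
        eq : ∀ b₂ b₀ → b₂ - b₀ ≡ 1ℤ * (b₂ - b₀ - 0ℤ)
        eq = solve-∀

    -- In the isotope the product of `i ∙ b` and `a ∙ j` is `i ∙ j`, so the logarithms of column
    -- `b`, of row `a` and of the entries serve as `A`, `B` and `C`.
    not-cyclic : NotCyclic p
    not-cyclic a b L = not-injective (λ i → log (i ∙ b)) (λ j → log (a ∙ j)) log
      (λ {x} {y} x≈y → log-cong (∙-cong {a} {a} {x} {y} ≈-refl x≈y)) log-cong
      (λ i j → ≈-trans
        (log-cong (≈-sym (∙-cong {(i ∙ b) // b} {i} {a \\ (a ∙ j)} {j} (rightDividesʳ b i) (leftDividesʳ a j))))
        (log-∙ (i ∙ b) (a ∙ j)))
      (λ {x} {y} eq → QuasigroupProperties.cancelˡ quasigroup a x y (log-injective eq))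
      where open Logarithm L

    open FalconerConstruction p-prime quasigroup order (connected p-prime N-nonempty) not-cyclic

    falconer : (c ℓ : Level) → Σ (FalconerVariety c ℓ) λ 𝒱 → Σ (Loop c ℓ) λ S →
      IsSmallestNonTrivialMember (FalconerVariety.variety 𝒱) S × HasOrder S p
    falconer c ℓ = falconerVariety c ℓ , smallest c ℓ , smallest-isSmallest c ℓ , smallest-order c ℓ

-- The powers of - 2 and their complement.

module PowersOfMinusTwo
  (m : ℕ) (p-prime : Prime (suc (suc m ℕ.+ suc m)))
  (-2^q≈1 : Congruence._≈_ (suc (suc m ℕ.+ suc m)) ((- + 2) ^ suc m) 1ℤ)
  where

  q p : ℕ
  q = suc m
  p = suc (q ℕ.+ q)

  open Congruence p
  open CongruenceProperties p
  open PrimeField p-prime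

  g : ℤ
  g = - + 2

  g≉0 : ¬ g ≈ 0ℤ
  g≉0 g≈0 = pos≉0 {2} (s≤s z≤n) (s≤s (s≤s (ℕ.≤-trans (s≤s z≤n) (ℕ.≤-reflexive (sym (ℕ.+-suc m m)))))) (neg-cong g≈0)

  ^-+ : ∀ i j → g ^ (i ℕ.+ j) ≡ g ^ i * g ^ j
  ^-+ = ℤ.^-distribˡ-+-* g

  -- Exponents below q reach every power, as (- 2)^q ≈ 1, whether or not q is the exact order; the
  -- finite range makes `S` decidable.
  S : ℤ → Set
  S x = x ≈ 0ℤ ⊎ ∃ λ (k : Fin q) → x ≈ g ^ toℕ k

  S-power : ∀ {x} k → x ≈ g ^ k → S x
  S-power {x} k eq = inj₂ (Fin.fromℕ< k%q<q , ≈-trans eq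
    (subst (λ j → g ^ k ≈ g ^ j) (sym (Fin.toℕ-fromℕ< k%q<q)) reduce))
    where
    k%q<q = ℕ.m%n<n k q
    power-q : ∀ j → g ^ (j ℕ.* q) ≈ 1ℤ
    power-q zero    = ≈-refl
    power-q (suc j) = ≈-trans (≡⇒≈ (^-+ q (j ℕ.* q))) (*-cong -2^q≈1 (power-q j))
    reduce : g ^ k ≈ g ^ (k % q)
    reduce = ≈-trans (≡⇒≈ (trans (cong (g ^_) (ℕ.m≡m%n+[m/n]*n k q)) (^-+ (k % q) (k ℕ./ q ℕ.* q))))
      (≈-trans (scale (g ^ (k % q)) (power-q (k ℕ./ q))) (≡⇒≈ (ℤ.*-identityʳ (g ^ (k % q)))))

  S-double : ∀ {x} → S x → S (g * x)
  S-double (inj₁ x≈0)       = inj₁ (scale g x≈0)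
  S-double (inj₂ (k , x≈)) = S-power (suc (toℕ k)) (scale g x≈)

  S-halve : ∀ {x} → S (g * x) → S x
  S-halve {x} (inj₁ gx≈0)       = inj₁ ([ (λ g≈0 → contradiction g≈0 g≉0) , (λ x≈0 → x≈0) ]′ (integral g x gx≈0))
  -- Division by g is multiplication by g^(q - 1), and q - 1 = `m`.
  S-halve {x} (inj₂ (k , gx≈)) = S-power (m ℕ.+ toℕ k) (*-cancelˡ g g≉0 (begin
    g * x                          ≈⟨ gx≈ ⟩
    g ^ toℕ k                      ≡⟨ ℤ.*-identityˡ (g ^ toℕ k) ⟨
    1ℤ * g ^ toℕ k                 ≈⟨ *-cong -2^q≈1 ≈-refl ⟨
    g ^ q * g ^ toℕ k              ≡⟨ ^-+ q (toℕ k) ⟨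
    g ^ (q ℕ.+ toℕ k)              ∎))
    where open SetoidReasoning ≈-setoid

  S-resp : ∀ {x y} → x ≈ y → S x → S y
  S-resp x≈y (inj₁ x≈0)       = inj₁ (≈-trans (≈-sym x≈y) x≈0)
  S-resp x≈y (inj₂ (k , x≈)) = inj₂ (k , ≈-trans (≈-sym x≈y) x≈)

  S? : ∀ x → Dec (S x)
  S? x = (x ≈? 0ℤ) ⊎-dec Fin.any? (λ k → x ≈? g ^ toℕ k)

  N : ℤ → Set
  N x = ¬ S x

  code : ∀ {x} → S x → Fin (suc q)
  code (inj₁ _)       = Fin.zero
  code (inj₂ (k , _)) = Fin.suc k

  decode : Fin (suc q) → ℤ
  decode Fin.zero    = 0ℤ
  decode (Fin.suc k) = g ^ toℕ k

  decode-code : ∀ {x} (s : S x) → x ≈ decode (code s)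
  decode-code (inj₁ x≈0)      = x≈0
  decode-code (inj₂ (_ , x≈)) = x≈

  code-injective : ∀ {x y} (s : S x) (t : S y) → code s ≡ code t → x ≈ y
  code-injective {y = y} s t eq =
    ≈-trans (decode-code s) (subst (λ k → decode k ≈ y) (sym eq) (≈-sym (decode-code t)))

  -- `S` has at most q + 1 residues, fewer than p = 2 q + 1.
  not-all-S : ¬ (∀ (i : Fin p) → S (+ toℕ i))
  not-all-S all = distinct (Fin.pigeonhole (s≤s (ℕ.m<m+n q (s≤s z≤n))) (λ i → code (all i)))
    where
    distinct : ¬ (∃₂ λ i j → i Fin.< j × code (all i) ≡ code (all j))
    distinct (i , j , i<j , eq) = Fin.<⇒≢ i<j (toℕ-injective (code-injective (all i) (all j) eq))

  N-nonempty : ∃ N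
  N-nonempty = + toℕ (proj₁ outside) , proj₂ outside
    where
    outside : ∃ λ (i : Fin p) → N (+ toℕ i)
    outside = Fin.¬∀⟶∃¬ p (λ i → S (+ toℕ i)) (λ i → S? (+ toℕ i)) not-all-S

  complement : DoublingClosed p
  complement = record
    { N      = N
    ; N?     = λ x → ¬? (S? x)
    ; N-resp = λ x≈y x∉S y∈S → x∉S (S-resp (≈-sym x≈y) y∈S)
    ; double = λ x∉S gx∈S → x∉S (S-halve gx∈S)
    ; halve  = λ gx∉S x∈S → gx∉S (S-double x∈S)
    }

  0∈S : S 0ℤ
  0∈S = inj₁ ≈-refl

  1∈S : S 1ℤ
  1∈S = S-power 0 ≈-refl

  -2∈S : S (- + 2)
  -2∈S = S-power 1 (≡⇒≈ (sym (ℤ.*-identityʳ g)))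

falconer-prime : (c ℓ : Level) (p : ℕ) → Prime p → 3 < p →
  (q : ℕ) → p ≡ suc (q ℕ.+ q) → Congruence._≈_ p ((- + 2) ^ q) 1ℤ →
  Σ (FalconerVariety c ℓ) λ 𝒱 → Σ (Loop c ℓ) λ S →
    IsSmallestNonTrivialMember (FalconerVariety.variety 𝒱) S × HasOrder S p
falconer-prime c ℓ p p-prime (s≤s ()) zero refl -2^q≈1
falconer-prime c ℓ p p-prime 3<p (suc m) refl -2^q≈1 =
  LatinSquare.falconer (suc m) complement p-prime 3<p N-nonempty
    (λ 0∉S → 0∉S 0∈S) (λ 1∉S → 1∉S 1∈S) (λ -2∉S → -2∉S -2∈S) c ℓ
  where open PowersOfMinusTwo m p-prime -2^q≈1 using (complement; N-nonempty; 0∈S; 1∈S; -2∈S)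

theorem1p2 : (c ℓ : Level) (p : ℕ) → Prime p → 3 < p →
    (p % 8 ≡ 1) ⊎ (p % 8 ≡ 3) →
    Σ (FalconerVariety c ℓ) λ 𝒱 →
    Σ (Loop c ℓ) λ S →
    IsSmallestNonTrivialMember (FalconerVariety.variety 𝒱) S × HasOrder S p
theorem1p2 c ℓ p p-prime 3<p (inj₁ p%8≡1) =
  falconer-prime c ℓ p p-prime 3<p (r ℕ.+ r) p≡ (MinusTwo.-2^q≈1 p-prime l r p≡ (inj₁ refl))
  where
  l = p ℕ./ 8
  r = l ℕ.+ l
  arith : ∀ l → 1 ℕ.+ l ℕ.* 8 ≡ suc (((l ℕ.+ l) ℕ.+ (l ℕ.+ l)) ℕ.+ ((l ℕ.+ l) ℕ.+ (l ℕ.+ l)))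
  arith = ℕ.solve-∀
  p≡ : p ≡ suc ((r ℕ.+ r) ℕ.+ (r ℕ.+ r))
  p≡ = trans (ℕ.m≡m%n+[m/n]*n p 8) (trans (cong (ℕ._+ l ℕ.* 8) p%8≡1) (arith l))
theorem1p2 c ℓ p p-prime 3<p (inj₂ p%8≡3) =
  falconer-prime c ℓ p p-prime 3<p (suc r ℕ.+ r) p≡ (MinusTwo.-2^q≈1 p-prime l (suc r) p≡ (inj₂ refl))
  where
  l = p ℕ./ 8
  r = l ℕ.+ l
  arith : ∀ l → 3 ℕ.+ l ℕ.* 8 ≡
          suc ((suc (l ℕ.+ l) ℕ.+ (l ℕ.+ l)) ℕ.+ (suc (l ℕ.+ l) ℕ.+ (l ℕ.+ l)))
  arith = ℕ.solve-∀
  p≡ : p ≡ suc ((suc r ℕ.+ r) ℕ.+ (suc r ℕ.+ r))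
  p≡ = trans (ℕ.m≡m%n+[m/n]*n p 8) (trans (cong (ℕ._+ l ℕ.* 8) p%8≡3) (arith l))
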